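{- Let $k\ge 4$, $m\ge k$, and $b$ an integer with $k-2\le b\le \frac{km-4k+4}{k-2}$ and $k(m-b)$ even. Define $$f(k,m,b)(q)=\binom{m}{k}_q-q^{\frac{k(m-b)}{2}+b-2k+2}\binom{b}{k-2}_q .$$ If $f(k,m,b)$ is nonnegative and unimodal, then $f(k,m,b-(2k-6))$ is also nonnegative and unimodal.
   Context: For integers $m\ge k\ge 0$ the $q$-binomial coefficient is $\binom{m}{k}_q=\prod_{i=1}^{m}(1-q^i)\big/\big(\prod_{i=1}^{k}(1-q^i)\prod_{i=1}^{m-k}(1-q^i)\big)$; by convention $\binom{n}{j}_q=0$ if $n<j$. A polynomial is nonnegative if all its coefficients are $\ge 0$, and unimodal if its coefficient sequence weakly increases up to some index and weakly decreases afterwards. -}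

module Defs where

open import Data.Nat as ℕ using (ℕ; zero; suc)
open import Data.Integer as ℤ using (ℤ; +_; -[1+_]; 0ℤ; 1ℤ; ∣_∣)
open import Data.Integer.DivMod using (_/ℕ_)
open import Data.List using (List; []; _∷_; replicate; _++_; map)
open import Data.Product using (∃)

-- Polynomials in q with integer coefficients, as coefficient lists:
-- the i-th entry is the coefficient of q^i.
Poly : Set
Poly = List ℤ

coeff : Poly → ℕ → ℤ
coeff []       _       = 0ℤ
coeff (a ∷ p)  zero    = a
coeff (a ∷ p)  (suc i) = coeff p i

_⊕_ : Poly → Poly → Poly
[]      ⊕ q       = q
(a ∷ p) ⊕ []      = a ∷ p
(a ∷ p) ⊕ (b ∷ q) = (a ℤ.+ b) ∷ (p ⊕ q)

⊖_ : Poly → Poly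
⊖ p = map ℤ.-_ p

_⊝_ : Poly → Poly → Poly
p ⊝ q = p ⊕ (⊖ q)

shift : ℕ → Poly → Poly
shift e p = replicate e 0ℤ ++ p

-- Gaussian (q-)binomial coefficient [m choose k]_q, via q-Pascal recursion
-- [m+1, k+1] = [m, k] + q^(k+1) [m, k+1];  [m,0] = 1;  [0,k+1] = 0.
-- (Equals the product quotient of the paper; is 0 when m < k.)
qbinom : ℕ → ℕ → Poly
qbinom _       zero    = 1ℤ ∷ []
qbinom zero    (suc k) = []
qbinom (suc m) (suc k) = qbinom m k ⊕ shift (suc k) (qbinom m (suc k))

-- q-binomial with integer top entry: 0 when the top is negative (n < j convention)
qbinomℤ : ℤ → ℕ → Poly
qbinomℤ (+ n)    j = qbinom n j
qbinomℤ -[1+ n ] j = []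

-- exponent k(m-b)/2 + b - 2k + 2 (computed in ℤ; nonnegative under the
-- theorem's hypotheses, where it is used as a natural number)
fexp : ℕ → ℕ → ℤ → ℤ
fexp k m b =
  ((+ k) ℤ.* ((+ m) ℤ.- b)) /ℕ 2 ℤ.+ b ℤ.- (+ (2 ℕ.* k)) ℤ.+ (+ 2)

f : ℕ → ℕ → ℤ → Poly
f k m b = qbinom m k ⊝ shift ∣ fexp k m b ∣ (qbinomℤ b (k ℕ.∸ 2))

Nonnegative : Poly → Set
Nonnegative p = ∀ i → 0ℤ ℤ.≤ coeff p i

Unimodal : Poly → Set
Unimodal p = ∃ λ j →
  (∀ i → suc i ℕ.≤ j → coeff p i ℤ.≤ coeff p (suc i)) ×′
  (∀ i → j ℕ.≤ i → coeff p (suc i) ℤ.≤ coeff p i)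
  where open import Data.Product using () renaming (_×_ to _×′_)

{-# OPTIONS --safe #-}

-- Write j = k − 2, b = n + j. Then f(k, m, b − (2k − 6)) − f(k, m, b) is a power of q times
--   G = [n + j, j] − q^(j(j−1)) [n + j − 2(j − 1), j],
-- and all these polynomials are symmetric about the same centre, so it suffices that the
-- coefficients of G increase up to the middle.
-- The coefficient of q^i in [n + j, j] is the number of monomials of degree n and weight i in
-- variables b₀, …, b_j, where b_r has weight j − r. The Lie algebra sl₂ acts on these polynomials,
-- namely on Symⁿ of its irreducible representation of dimension j + 1. Let D be an invariant of
-- degree 2(j − 1) (a power of the quadratic invariant if j is even, and of the discriminant of
-- the quadratic covariant if j is odd). Multiplication by D is injective and commutes with sl₂,
-- so it embeds Symⁿ⁻²⁽ʲ⁻¹⁾ into Symⁿ, and comparing dimensions of weight spaces gives the claim.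
module Submission where

open import Defs
open import Data.Nat using (ℕ; _≤_)
open import Data.Integer as ℤ using (ℤ; +_)
open import Data.Integer.Divisibility using (_∣_)
open import Data.Product using (_×_)

open import Data.Nat using (zero; suc; pred; _+_; _*_; _∸_; _<_; z≤n; s≤s; s≤s⁻¹; _≟_; _≤?_; ⌊_/2⌋; ⌈_/2⌉)
import Data.Nat.Properties as ℕₚ
import Data.Nat.Tactic.RingSolver as ℕ-Solver
open import Data.Integer using (-[1+_]; 0ℤ; 1ℤ; -1ℤ)
import Data.Integer.Properties as ℤₚ
open import Data.Integer.DivMod using (_/ℕ_; _%ℕ_; n%ℕd<d; a≡a%ℕn+[a/ℕn]*n)
import Data.Integer.Divisibility.Signed as Signed
open import Data.Integer.Tactic.RingSolver using (solve-∀)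
open import Data.List using (List; []; _∷_; _++_; map; length)
open import Data.List.Properties using (length-map; length-++; length-++-sucʳ)
open import Data.List.Relation.Unary.All as All using (All; []; _∷_)
import Data.List.Relation.Unary.All.Properties as Allₚ
open import Data.List.Relation.Unary.Any using (here; there)
open import Data.List.Relation.Unary.AllPairs using ([]; _∷_)
open import Data.List.Relation.Unary.Unique.Propositional using (Unique)
import Data.List.Relation.Unary.Unique.Propositional.Properties as Uniqueₚ
open import Data.List.Membership.Propositional using (_∈_; _∉_)
open import Data.List.Membership.Propositional.Properties using (∈-map⁺; ∈-map⁻; ∈-++⁺ˡ; ∈-++⁺ʳ; ∈-++⁻)
open import Data.Vec using (Vec; []; _∷_; _∷ʳ_; reverse)
import Data.Vec.Properties as Vecₚ
open import Data.Product using (_,_; ∃; proj₁; proj₂)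
open import Data.Sum using (_⊎_; inj₁; inj₂; [_,_]′)
import Data.Sum.Properties as Sumₚ
open import Relation.Nullary using (¬_; Dec; yes; no; contradiction)
open import Relation.Binary.Definitions using (DecidableEquality)
open import Relation.Binary.PropositionalEquality

-- Joint zeros of linear functionals

-- The number 2k - 6 = 2(j - 1) is the degree of the discriminant of a binary form of degree j.
-- Replacing b by b - (2k - 6) raises the exponent by k(k - 3) - (2k - 6) = j(j - 1), the weight of
-- an invariant of that degree. That multiplication by D embeds one space into the other bounds
-- coefficients, not their increments. Below the middle the increment of a weight multiplicity
-- counts the vectors killed by `lowering`, and D maps such vectors to such vectors. Both facts are
-- packed into one injective linear map in `count-supermodular`, so that no kernel, quotient or
-- decomposition into irreducibles has to be built: every dimension is the length of a list of
-- monomials, compared through solvability of linear systems over ℤ. The obstacle is an explicit D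
-- that is visibly not a zero divisor. Powers of an invariant of degree 2 or 4 serve because their
-- leading part in b₀ can be read off, which is hard for the discriminant of the form itself. If b -
-- (2k - 6) < j, the second q-binomial is 0, G is [n + j, j] alone, and its own increase up to the
-- middle suffices.

x*y≡0⇒y≡0 : ∀ x {y} → x ≢ 0ℤ → x ℤ.* y ≡ 0ℤ → y ≡ 0ℤ
x*y≡0⇒y≡0 x x≢0 eq = [ (λ x≡0 → contradiction x≡0 x≢0) , (λ y≡0 → y≡0) ]′ (ℤₚ.i*j≡0⇒i≡0∨j≡0 x eq)

record Functional (X : Set) : Set where
  field
    app  : (X → ℤ) → ℤ
    ext  : ∀ {u v} → (∀ x → u x ≡ v x) → app u ≡ app v
    lin  : ∀ a b u v → app (λ x → a ℤ.* u x ℤ.+ b ℤ.* v x) ≡ a ℤ.* app u ℤ.+ b ℤ.* app v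

open Functional

combination : ∀ {X} → ℤ → Functional X → ℤ → Functional X → Functional X
combination a φ b ψ .app u = a ℤ.* app φ u ℤ.+ b ℤ.* app ψ u
combination a φ b ψ .ext eq = cong₂ (λ s t → a ℤ.* s ℤ.+ b ℤ.* t) (ext φ eq) (ext ψ eq)
combination a φ b ψ .lin c d u v = trans
  (cong₂ (λ s t → a ℤ.* s ℤ.+ b ℤ.* t) (lin φ c d u v) (lin ψ c d u v))
  (lemma a b c d (app φ u) (app φ v) (app ψ u) (app ψ v))
  where
  lemma : ∀ a b c d s t s′ t′ →
    a ℤ.* (c ℤ.* s ℤ.+ d ℤ.* t) ℤ.+ b ℤ.* (c ℤ.* s′ ℤ.+ d ℤ.* t′) ≡
    c ℤ.* (a ℤ.* s ℤ.+ b ℤ.* s′) ℤ.+ d ℤ.* (a ℤ.* t ℤ.+ b ℤ.* t′)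
  lemma = solve-∀

module _ {X : Set} (_≟_ : DecidableEquality X) where

  δ : X → X → ℤ
  δ x y with x ≟ y
  ... | yes _ = 1ℤ
  ... | no  _ = 0ℤ

  δ-diag : ∀ x → δ x x ≡ 1ℤ
  δ-diag x with x ≟ x
  ... | yes _   = refl
  ... | no  x≢x = contradiction refl x≢x

  δ-off : ∀ {x y} → x ≢ y → δ x y ≡ 0ℤ
  δ-off {x} {y} x≢y with x ≟ y
  ... | yes x≡y = contradiction x≡y x≢y
  ... | no  _   = refl

  Supported : List X → (X → ℤ) → Set
  Supported S v = ∀ x → x ∉ S → v x ≡ 0ℤ

  Annihilated : List (Functional X) → (X → ℤ) → Set
  Annihilated Φ v = All (λ φ → app φ v ≡ 0ℤ) Φ

  data Pivot (v : X → ℤ) : List (Functional X) → Set where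
    none  : ∀ {Φ} → Annihilated Φ v → Pivot v Φ
    pivot : ∀ Φ φ Ψ → app φ v ≢ 0ℤ → Pivot v (Φ ++ φ ∷ Ψ)

  findPivot : ∀ v Φ → Pivot v Φ
  findPivot v [] = none []
  findPivot v (φ ∷ Φ) with app φ v ℤ.≟ 0ℤ
  ... | no  ≢0 = pivot [] φ Φ ≢0
  ... | yes ≡0 with findPivot v Φ
  ...   | none all0        = none (≡0 ∷ all0)
  ...   | pivot Φ′ ψ Ψ ≢0 = pivot (φ ∷ Φ′) ψ Ψ ≢0

  -- Gaussian elimination without fractions. If every functional kills the unit vector at s, that
  -- vector is the answer; otherwise a functional φ with φ(`δ s`) ≠ 0 is the pivot, the others are
  -- cross-multiplied with it so that they kill `δ s`, and the induction runs on S without s.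
  commonZero : ∀ S → Unique S → ∀ Φ → length Φ < length S →
    ∃ λ v → Supported S v × (∃ λ x → v x ≢ 0ℤ) × Annihilated Φ v
  commonZero (s ∷ S) (s∉S ∷ uniq) Φ |Φ|<|S| with findPivot (δ s) Φ
  ... | none all0 =
    δ s , (λ x x∉ → δ-off (λ { refl → x∉ (here refl) }))
        , (s , λ eq → contradiction (trans (sym (δ-diag s)) eq) λ ()) , all0
  ... | pivot Φ₁ φ Φ₂ p≢0 with commonZero S uniq (map eliminate (Φ₁ ++ Φ₂)) smaller
    where
    eliminate : Functional X → Functional X
    eliminate ψ = combination (app φ (δ s)) ψ (ℤ.- app ψ (δ s)) φ
    smaller : length (map eliminate (Φ₁ ++ Φ₂)) < length S
    smaller rewrite length-map eliminate (Φ₁ ++ Φ₂) =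
      s≤s⁻¹ (subst (_< suc (length S)) (length-++-sucʳ Φ₁ φ Φ₂) |Φ|<|S|)
  ...   | v , supp , (x , vx≢0) , ann =
    w , wsupp , (x , wx≢0) , Allₚ.++⁺ (All.map (λ {ψ} → back ψ) ann₁) (φw≡0 ∷ All.map (λ {ψ} → back ψ) ann₂)
    where
    p q : ℤ
    p = app φ (δ s)
    q = app φ v
    -- The solution on the smaller support is scaled by p so that its value at s can be the integer
    -- -q, for which φ(w) = pq - qp = 0.
    w : X → ℤ
    w y = p ℤ.* v y ℤ.+ (ℤ.- q) ℤ.* δ s y
    s∉ : s ∉ S
    s∉ s∈ = All.lookup s∉S s∈ refl
    wsupp : Supported (s ∷ S) w
    wsupp y y∉ = trans
      (cong₂ (λ a b → p ℤ.* a ℤ.+ (ℤ.- q) ℤ.* b) (supp y (λ y∈ → y∉ (there y∈))) (δ-off (λ { refl → y∉ (here refl) })))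
      (lemma p q)
      where
      lemma : ∀ p q → p ℤ.* 0ℤ ℤ.+ (ℤ.- q) ℤ.* 0ℤ ≡ 0ℤ
      lemma = solve-∀
    s≢x : s ≢ x
    s≢x refl = vx≢0 (supp s s∉)
    wx≢0 : w x ≢ 0ℤ
    wx≢0 eq = vx≢0 (x*y≡0⇒y≡0 p p≢0 (trans (lemma p (v x) q) (trans (cong (λ b → p ℤ.* v x ℤ.+ (ℤ.- q) ℤ.* b) (sym (δ-off s≢x))) eq)))
      where
      lemma : ∀ p a q → p ℤ.* a ≡ p ℤ.* a ℤ.+ (ℤ.- q) ℤ.* 0ℤ
      lemma = solve-∀
    φw≡0 : app φ w ≡ 0ℤ
    φw≡0 = trans (lin φ p (ℤ.- q) v (δ s)) (lemma p q)
      where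
      lemma : ∀ p q → p ℤ.* q ℤ.+ (ℤ.- q) ℤ.* p ≡ 0ℤ
      lemma = solve-∀
    back : ∀ ψ → p ℤ.* app ψ v ℤ.+ (ℤ.- app ψ (δ s)) ℤ.* q ≡ 0ℤ → app ψ w ≡ 0ℤ
    back ψ eq = trans (lin ψ p (ℤ.- q) v (δ s)) (trans (lemma p q (app ψ v) (app ψ (δ s))) eq)
      where
      lemma : ∀ p q a b → p ℤ.* a ℤ.+ (ℤ.- q) ℤ.* b ≡ p ℤ.* a ℤ.+ (ℤ.- b) ℤ.* q
      lemma = solve-∀
    ann₁ = Allₚ.++⁻ˡ Φ₁ (Allₚ.map⁻ ann)
    ann₂ = Allₚ.++⁻ʳ Φ₁ (Allₚ.map⁻ ann)

  -- The tool for all dimension comparisons: S indexes a basis of the source, Φ lists the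
  -- coordinates of a linear map, and the hypothesis is that this map is injective.
  length≤ : ∀ S → Unique S → ∀ Φ →
    (∀ v → Supported S v → Annihilated Φ v → ∀ x → v x ≡ 0ℤ) → length S ≤ length Φ
  length≤ S uniq Φ inj with length S ℕₚ.≤? length Φ
  ... | yes ≤ = ≤
  ... | no  ≰ with commonZero S uniq Φ (ℕₚ.≰⇒> ≰)
  ...   | v , supp , (x , vx≢0) , ann = contradiction (inj v supp ann x) vx≢0

-- Monomials as exponent vectors, and the coefficients of q-binomials

-- The value 0 past the end makes multiplication by an absent variable zero, so b_{j+1} may appear
-- in formulas and drops out of them.
at : ∀ {m} → Vec ℕ m → ℕ → ℕ
at []      _       = 0
at (x ∷ e) zero    = x
at (x ∷ e) (suc p) = at e p

inc dec : ∀ {m} → ℕ → Vec ℕ m → Vec ℕ m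
inc _       []      = []
inc zero    (x ∷ e) = suc x ∷ e
inc (suc p) (x ∷ e) = x ∷ inc p e
dec _       []      = []
dec zero    (x ∷ e) = pred x ∷ e
dec (suc p) (x ∷ e) = x ∷ dec p e

deg : ∀ {m} → Vec ℕ m → ℕ
deg []      = 0
deg (x ∷ e) = x + deg e

wt : ∀ {m} → Vec ℕ m → ℕ
wt [] = 0
wt {suc m} (x ∷ e) = m * x + wt e

at-beyond : ∀ {m} (e : Vec ℕ m) {p} → m ≤ p → at e p ≡ 0
at-beyond []      _         = refl
at-beyond (x ∷ e) (s≤s m≤p) = at-beyond e m≤p

at-inc-≢ : ∀ {m} (e : Vec ℕ m) p q → p ≢ q → at (inc p e) q ≡ at e q
at-inc-≢ []      p       q       p≢q = refl
at-inc-≢ (x ∷ e) zero    zero    p≢q = contradiction refl p≢q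
at-inc-≢ (x ∷ e) zero    (suc q) p≢q = refl
at-inc-≢ (x ∷ e) (suc p) zero    p≢q = refl
at-inc-≢ (x ∷ e) (suc p) (suc q) p≢q = at-inc-≢ e p q (λ p≡q → p≢q (cong suc p≡q))

at-inc : ∀ {m} (e : Vec ℕ m) p → p < m → at (inc p e) p ≡ suc (at e p)
at-inc (x ∷ e) zero    _         = refl
at-inc (x ∷ e) (suc p) (s≤s p<m) = at-inc e p p<m

at-dec-≢ : ∀ {m} (e : Vec ℕ m) p q → p ≢ q → at (dec p e) q ≡ at e q
at-dec-≢ []      p       q       p≢q = refl
at-dec-≢ (x ∷ e) zero    zero    p≢q = contradiction refl p≢q
at-dec-≢ (x ∷ e) zero    (suc q) p≢q = refl
at-dec-≢ (x ∷ e) (suc p) zero    p≢q = refl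
at-dec-≢ (x ∷ e) (suc p) (suc q) p≢q = at-dec-≢ e p q (λ p≡q → p≢q (cong suc p≡q))

at-dec-0 : ∀ {m} (e : Vec ℕ m) → at (dec 0 e) 0 ≡ pred (at e 0)
at-dec-0 []      = refl
at-dec-0 (x ∷ e) = refl

inc-comm : ∀ {m} p q (e : Vec ℕ m) → inc p (inc q e) ≡ inc q (inc p e)
inc-comm p       q       []      = refl
inc-comm zero    zero    (x ∷ e) = refl
inc-comm zero    (suc q) (x ∷ e) = refl
inc-comm (suc p) zero    (x ∷ e) = refl
inc-comm (suc p) (suc q) (x ∷ e) = cong (x ∷_) (inc-comm p q e)

dec-comm : ∀ {m} p q (e : Vec ℕ m) → dec p (dec q e) ≡ dec q (dec p e)
dec-comm p       q       []      = refl
dec-comm zero    zero    (x ∷ e) = refl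
dec-comm zero    (suc q) (x ∷ e) = refl
dec-comm (suc p) zero    (x ∷ e) = refl
dec-comm (suc p) (suc q) (x ∷ e) = cong (x ∷_) (dec-comm p q e)

dec-inc-comm : ∀ {m} p q (e : Vec ℕ m) → p ≢ q → dec q (inc p e) ≡ inc p (dec q e)
dec-inc-comm p       q       []      p≢q = refl
dec-inc-comm zero    zero    (x ∷ e) p≢q = contradiction refl p≢q
dec-inc-comm zero    (suc q) (x ∷ e) p≢q = refl
dec-inc-comm (suc p) zero    (x ∷ e) p≢q = refl
dec-inc-comm (suc p) (suc q) (x ∷ e) p≢q = cong (x ∷_) (dec-inc-comm p q e (λ p≡q → p≢q (cong suc p≡q)))

dec-inc : ∀ {m} p (e : Vec ℕ m) → dec p (inc p e) ≡ e
dec-inc p       []      = refl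
dec-inc zero    (x ∷ e) = refl
dec-inc (suc p) (x ∷ e) = cong (x ∷_) (dec-inc p e)

inc-dec : ∀ {m} p (e : Vec ℕ m) → at e p ≢ 0 → inc p (dec p e) ≡ e
inc-dec p       []          ≢0 = refl
inc-dec zero    (zero ∷ e)  ≢0 = contradiction refl ≢0
inc-dec zero    (suc x ∷ e) ≢0 = refl
inc-dec (suc p) (x ∷ e)     ≢0 = cong (x ∷_) (inc-dec p e ≢0)

deg-inc : ∀ {m} p (e : Vec ℕ m) → p < m → deg (inc p e) ≡ suc (deg e)
deg-inc zero    (x ∷ e) _         = refl
deg-inc (suc p) (x ∷ e) (s≤s p<m) = trans (cong (_+_ x) (deg-inc p e p<m)) (ℕₚ.+-suc x (deg e))

-- The variable of index p has weight m - p; moving p to the left avoids truncated subtraction.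
wt-inc : ∀ {m} p (e : Vec ℕ (suc m)) → p ≤ m → p + wt (inc p e) ≡ m + wt e
wt-inc {m}     zero    (x ∷ e) _         = lemma m x (wt e)
  where
  lemma : ∀ m x w → m * suc x + w ≡ m + (m * x + w)
  lemma = ℕ-Solver.solve-∀
wt-inc {suc m} (suc p) (x ∷ e) (s≤s p≤m) = trans (lemma₁ m p x (wt (inc p e))) (trans (cong (λ t → suc m * x + suc t) (wt-inc p e p≤m)) (lemma₂ m x (wt e)))
  where
  lemma₁ : ∀ m p x w → suc p + (suc m * x + w) ≡ suc m * x + suc (p + w)
  lemma₁ = ℕ-Solver.solve-∀
  lemma₂ : ∀ m x w → suc m * x + suc (m + w) ≡ suc m + (suc m * x + w)
  lemma₂ = ℕ-Solver.solve-∀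

at-0≤deg : ∀ {m} (e : Vec ℕ m) → at e 0 ≤ deg e
at-0≤deg []      = z≤n
at-0≤deg (x ∷ e) = ℕₚ.m≤m+n x (deg e)

deg-∷ʳ : ∀ {m} (e : Vec ℕ m) x → deg (e ∷ʳ x) ≡ deg e + x
deg-∷ʳ []      x = ℕₚ.+-identityʳ x
deg-∷ʳ (y ∷ e) x = trans (cong (_+_ y) (deg-∷ʳ e x)) (sym (ℕₚ.+-assoc y (deg e) x))

wt-∷ʳ : ∀ {m} (e : Vec ℕ m) x → wt (e ∷ʳ x) ≡ wt e + deg e
wt-∷ʳ []          x = refl
wt-∷ʳ {suc m} (y ∷ e) x = trans (cong (_+_ (suc m * y)) (wt-∷ʳ e x)) (lemma m y (wt e) (deg e))
  where
  lemma : ∀ m y w d → suc m * y + (w + d) ≡ m * y + w + (y + d)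
  lemma = ℕ-Solver.solve-∀

deg-reverse : ∀ {m} (e : Vec ℕ m) → deg (reverse e) ≡ deg e
deg-reverse []      = refl
deg-reverse (x ∷ e) = begin
  deg (reverse (x ∷ e)) ≡⟨ cong deg (Vecₚ.reverse-∷ x e) ⟩
  deg (reverse e ∷ʳ x)  ≡⟨ deg-∷ʳ (reverse e) x ⟩
  deg (reverse e) + x   ≡⟨ cong (_+ x) (deg-reverse e) ⟩
  deg e + x             ≡⟨ ℕₚ.+-comm (deg e) x ⟩
  x + deg e             ∎
  where open ≡-Reasoning

wt-reverse : ∀ {m} (e : Vec ℕ m) → wt e + wt (reverse e) + deg e ≡ m * deg e
wt-reverse []      = refl
wt-reverse {suc m} (x ∷ e) = begin
  m * x + wt e + wt (reverse (x ∷ e)) + (x + deg e)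
    ≡⟨ cong (λ t → m * x + wt e + t + (x + deg e)) (trans (cong wt (Vecₚ.reverse-∷ x e)) (wt-∷ʳ (reverse e) x)) ⟩
  m * x + wt e + (wt (reverse e) + deg (reverse e)) + (x + deg e)
    ≡⟨ cong (λ t → m * x + wt e + (wt (reverse e) + t) + (x + deg e)) (deg-reverse e) ⟩
  m * x + wt e + (wt (reverse e) + deg e) + (x + deg e)
    ≡⟨ lemma₁ m x (wt e) (wt (reverse e)) (deg e) ⟩
  (wt e + wt (reverse e) + deg e) + (suc m * x + deg e)
    ≡⟨ cong (_+ (suc m * x + deg e)) (wt-reverse e) ⟩
  m * deg e + (suc m * x + deg e)
    ≡⟨ lemma₂ m x (deg e) ⟩
  suc m * (x + deg e) ∎
  where
  open ≡-Reasoning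
  lemma₁ : ∀ m x w r d → m * x + w + (r + d) + (x + d) ≡ w + r + d + (suc m * x + d)
  lemma₁ = ℕ-Solver.solve-∀
  lemma₂ : ∀ m x d → m * d + (suc m * x + d) ≡ suc m * (x + d)
  lemma₂ = ℕ-Solver.solve-∀

record Homogeneous {m : ℕ} (o n i : ℕ) (e : Vec ℕ m) : Set where
  constructor _,_
  field
    deg≡ : deg e ≡ n
    wt≡  : o + wt e ≡ i

-- The offset o stands for a factor q^o. Splitting by whether the first variable occurs follows the
-- q-Pascal rule, so the lengths obey the recursion of `qbinom`.
monomials : ∀ j → ℕ → ℕ → ℕ → List (Vec ℕ (suc j))
monomials zero n o i with o ≟ i
... | yes _ = (n ∷ []) ∷ []
... | no  _ = []
monomials (suc j) zero    o i = map (0 ∷_) (monomials j 0 o i)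
monomials (suc j) (suc n) o i =
  map (0 ∷_) (monomials j (suc n) o i) ++ map (inc 0) (monomials (suc j) n (o + suc j) i)

wt-0∷ : ∀ {m} (e : Vec ℕ m) → wt (0 ∷ e) ≡ wt e
wt-0∷ {m} e = cong (λ t → t + wt e) (ℕₚ.*-zeroʳ m)

homogeneous-0∷ : ∀ {j n o i} {e : Vec ℕ (suc j)} → Homogeneous o n i e → Homogeneous o n i (0 ∷ e)
homogeneous-0∷ {o = o} {e = e} (deg≡ , wt≡) = deg≡ , trans (cong (_+_ o) (wt-0∷ e)) wt≡

homogeneous-inc-0 : ∀ {j n o i} {e : Vec ℕ (suc j)} → Homogeneous (o + j) n i e → Homogeneous o (suc n) i (inc 0 e)
homogeneous-inc-0 {j} {o = o} {e = e} (deg≡ , wt≡) =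
  trans (deg-inc 0 e (s≤s z≤n)) (cong suc deg≡) ,
  trans (cong (_+_ o) (wt-inc 0 e z≤n)) (trans (sym (ℕₚ.+-assoc o j (wt e))) wt≡)

monomials-homogeneous : ∀ j n o i → All (Homogeneous o n i) (monomials j n o i)
monomials-homogeneous zero n o i with o ≟ i
... | yes o≡i = (ℕₚ.+-identityʳ n , trans (ℕₚ.+-identityʳ o) o≡i) ∷ []
... | no  _   = []
monomials-homogeneous (suc j) zero    o i =
  Allₚ.map⁺ (All.map homogeneous-0∷ (monomials-homogeneous j zero o i))
monomials-homogeneous (suc j) (suc n) o i = Allₚ.++⁺
  (Allₚ.map⁺ (All.map homogeneous-0∷ (monomials-homogeneous j (suc n) o i)))
  (Allₚ.map⁺ (All.map (homogeneous-inc-0 {suc j}) (monomials-homogeneous (suc j) n (o + suc j) i)))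

∈-monomials⁺ : ∀ j n o i {e} → Homogeneous o n i e → e ∈ monomials j n o i
∈-monomials⁺ zero n o i {x ∷ []} (deg≡ , wt≡) with o ≟ i
... | yes _   = here (cong (_∷ []) (trans (sym (ℕₚ.+-identityʳ x)) deg≡))
... | no  o≢i = contradiction (trans (sym (ℕₚ.+-identityʳ o)) wt≡) o≢i
∈-monomials⁺ (suc j) zero o i {zero ∷ e} (deg≡ , wt≡) =
  ∈-map⁺ (0 ∷_) (∈-monomials⁺ j zero o i (deg≡ , trans (cong (_+_ o) (sym (wt-0∷ e))) wt≡))
∈-monomials⁺ (suc j) (suc n) o i {zero ∷ e} (deg≡ , wt≡) =
  ∈-++⁺ˡ (∈-map⁺ (0 ∷_) (∈-monomials⁺ j (suc n) o i (deg≡ , trans (cong (_+_ o) (sym (wt-0∷ e))) wt≡)))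
∈-monomials⁺ (suc j) (suc n) o i {suc x ∷ e} (deg≡ , wt≡) =
  ∈-++⁺ʳ (map (0 ∷_) (monomials j (suc n) o i)) (∈-map⁺ (inc 0)
    (∈-monomials⁺ (suc j) n (o + suc j) i {x ∷ e} (ℕₚ.suc-injective deg≡ ,
      trans (ℕₚ.+-assoc o (suc j) (wt (x ∷ e))) (trans (cong (_+_ o) (sym (wt-inc 0 (x ∷ e) z≤n))) wt≡))))

monomials-unique : ∀ j n o i → Unique (monomials j n o i)
monomials-unique zero n o i with o ≟ i
... | yes _ = [] ∷ []
... | no  _ = []
monomials-unique (suc j) zero    o i = Uniqueₚ.map⁺ Vecₚ.∷-injectiveʳ (monomials-unique j 0 o i)
monomials-unique (suc j) (suc n) o i = Uniqueₚ.++⁺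
  (Uniqueₚ.map⁺ Vecₚ.∷-injectiveʳ (monomials-unique j (suc n) o i))
  (Uniqueₚ.map⁺ inc-injective (monomials-unique (suc j) n (o + suc j) i))
  disjoint
  where
  inc-injective : ∀ {e e′ : Vec ℕ (suc (suc j))} → inc 0 e ≡ inc 0 e′ → e ≡ e′
  inc-injective {e} {e′} eq = trans (sym (dec-inc 0 e)) (trans (cong (dec 0) eq) (dec-inc 0 e′))
  disjoint : ∀ {e} → ¬ (e ∈ map (0 ∷_) (monomials j (suc n) o i) × e ∈ map (inc 0) (monomials (suc j) n (o + suc j) i))
  disjoint (e∈ˡ , e∈ʳ) with ∈-map⁻ (0 ∷_) e∈ˡ | ∈-map⁻ (inc 0) e∈ʳ
  ... | _ , _ , refl | x ∷ e , _ , ()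

coeff-⊕ : ∀ p q i → coeff (p ⊕ q) i ≡ coeff p i ℤ.+ coeff q i
coeff-⊕ []      q       i       = sym (ℤₚ.+-identityˡ (coeff q i))
coeff-⊕ (a ∷ p) []      i       = sym (ℤₚ.+-identityʳ (coeff (a ∷ p) i))
coeff-⊕ (a ∷ p) (b ∷ q) zero    = refl
coeff-⊕ (a ∷ p) (b ∷ q) (suc i) = coeff-⊕ p q i

coeff-⊖ : ∀ p i → coeff (⊖ p) i ≡ ℤ.- coeff p i
coeff-⊖ []      i       = refl
coeff-⊖ (a ∷ p) zero    = refl
coeff-⊖ (a ∷ p) (suc i) = coeff-⊖ p i

coeff-⊝ : ∀ p q i → coeff (p ⊝ q) i ≡ coeff p i ℤ.- coeff q i
coeff-⊝ p q i = trans (coeff-⊕ p (⊖ q) i) (cong (λ c → coeff p i ℤ.+ c) (coeff-⊖ q i))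

coeff-shift-cong : ∀ o p q → (∀ i → coeff p i ≡ coeff q i) → ∀ i → coeff (shift o p) i ≡ coeff (shift o q) i
coeff-shift-cong zero    p q eq i       = eq i
coeff-shift-cong (suc o) p q eq zero    = refl
coeff-shift-cong (suc o) p q eq (suc i) = coeff-shift-cong o p q eq i

coeff-shift-⊕ : ∀ o p q i → coeff (shift o (p ⊕ q)) i ≡ coeff (shift o p) i ℤ.+ coeff (shift o q) i
coeff-shift-⊕ zero    p q i       = coeff-⊕ p q i
coeff-shift-⊕ (suc o) p q zero    = refl
coeff-shift-⊕ (suc o) p q (suc i) = coeff-shift-⊕ o p q i

coeff-shift-[] : ∀ o i → coeff (shift o []) i ≡ 0ℤ
coeff-shift-[] zero    i       = refl
coeff-shift-[] (suc o) zero    = refl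
coeff-shift-[] (suc o) (suc i) = coeff-shift-[] o i

shift-shift : ∀ o o′ p → shift o (shift o′ p) ≡ shift (o + o′) p
shift-shift zero    o′ p = refl
shift-shift (suc o) o′ p = cong (0ℤ ∷_) (shift-shift o o′ p)

coeff-shift-1 : ∀ o i → coeff (shift o (1ℤ ∷ [])) i ≡ + length (monomials 0 0 o i)
coeff-shift-1 zero    zero    = refl
coeff-shift-1 zero    (suc i) = refl
coeff-shift-1 (suc o) zero    = refl
coeff-shift-1 (suc o) (suc i) with o ≟ i | suc o ≟ suc i | coeff-shift-1 o i
... | yes _   | yes _   | eq = eq
... | no  _   | no  _   | eq = eq
... | yes o≡i | no  neq | eq = contradiction (cong suc o≡i) neq
... | no  o≢i | yes eq′ | eq = contradiction (ℕₚ.suc-injective eq′) o≢i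

coeff-qbinom-< : ∀ m k → m < k → ∀ i → coeff (qbinom m k) i ≡ 0ℤ
coeff-qbinom-< zero    (suc k) _         i = refl
coeff-qbinom-< (suc m) (suc k) (s≤s m<k) i = trans
  (coeff-⊕ (qbinom m k) (shift (suc k) (qbinom m (suc k))) i)
  (cong₂ ℤ._+_ (coeff-qbinom-< m k m<k i)
    (trans (coeff-shift-cong (suc k) (qbinom m (suc k)) [] (coeff-qbinom-< m (suc k) (ℕₚ.m<n⇒m<1+n m<k)) i)
           (coeff-shift-[] (suc k) i)))

monomials-0 : ∀ n o i → length (monomials 0 n o i) ≡ length (monomials 0 0 o i)
monomials-0 n o i with o ≟ i
... | yes _ = refl
... | no  _ = refl

-- Induction along q-Pascal: monomials free of the first variable give the first summand, and
-- removing one copy of it, of weight j + 1, gives the second. In degree 0 the second summand is a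
-- q-binomial with top below bottom, hence 0.
coeff-shift-qbinom : ∀ j n o i → coeff (shift o (qbinom (n + j) j)) i ≡ + length (monomials j n o i)
coeff-shift-qbinom zero n o i = trans (coeff-shift-1 o i) (cong +_ (sym (monomials-0 n o i)))
coeff-shift-qbinom (suc j) n o i rewrite ℕₚ.+-suc n j = begin
  coeff (shift o (qbinom (n + j) j ⊕ shift (suc j) (qbinom (n + j) (suc j)))) i
    ≡⟨ coeff-shift-⊕ o (qbinom (n + j) j) (shift (suc j) (qbinom (n + j) (suc j))) i ⟩
  coeff (shift o (qbinom (n + j) j)) i ℤ.+ coeff (shift o (shift (suc j) (qbinom (n + j) (suc j)))) i
    ≡⟨ cong₂ ℤ._+_ (coeff-shift-qbinom j n o i) (cong (λ p → coeff p i) (shift-shift o (suc j) (qbinom (n + j) (suc j)))) ⟩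
  + length (monomials j n o i) ℤ.+ coeff (shift (o + suc j) (qbinom (n + j) (suc j))) i
    ≡⟨ tail n ⟩
  + length (monomials (suc j) n o i) ∎
  where
  open ≡-Reasoning
  tail : ∀ n → + length (monomials j n o i) ℤ.+ coeff (shift (o + suc j) (qbinom (n + j) (suc j))) i
               ≡ + length (monomials (suc j) n o i)
  tail zero = trans
    (cong (λ c → + length (monomials j zero o i) ℤ.+ c)
      (trans (coeff-shift-cong (o + suc j) (qbinom j (suc j)) [] (coeff-qbinom-< j (suc j) ℕₚ.≤-refl) i)
             (coeff-shift-[] (o + suc j) i)))
    (trans (ℤₚ.+-identityʳ _) (cong +_ (sym (length-map (0 ∷_) (monomials j 0 o i)))))
  tail (suc n) = trans
    (cong (λ c → + length (monomials j (suc n) o i) ℤ.+ c)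
      (trans (cong (λ m → coeff (shift (o + suc j) (qbinom m (suc j))) i) (sym (ℕₚ.+-suc n j)))
             (coeff-shift-qbinom (suc j) n (o + suc j) i)))
    (cong +_ (sym (trans
      (length-++ (map (0 ∷_) (monomials j (suc n) o i)))
      (cong₂ _+_ (length-map (0 ∷_) (monomials j (suc n) o i)) (length-map (inc 0) (monomials (suc j) n (o + suc j) i))))))

-- Differential operators on polynomials

∑ : ℕ → (ℕ → ℤ) → ℤ
∑ zero    f = 0ℤ
∑ (suc n) f = ∑ n f ℤ.+ f n

∑-cong : ∀ n {f g} → (∀ r → r < n → f r ≡ g r) → ∑ n f ≡ ∑ n g
∑-cong zero    eq = refl
∑-cong (suc n) eq = cong₂ ℤ._+_ (∑-cong n (λ r r<n → eq r (ℕₚ.m<n⇒m<1+n r<n))) (eq n ℕₚ.≤-refl)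

∑-zero : ∀ n {f} → (∀ r → r < n → f r ≡ 0ℤ) → ∑ n f ≡ 0ℤ
∑-zero zero    eq = refl
∑-zero (suc n) eq = cong₂ ℤ._+_ (∑-zero n (λ r r<n → eq r (ℕₚ.m<n⇒m<1+n r<n))) (eq n ℕₚ.≤-refl)

∑-lin : ∀ n a b f g → ∑ n (λ r → a ℤ.* f r ℤ.+ b ℤ.* g r) ≡ a ℤ.* ∑ n f ℤ.+ b ℤ.* ∑ n g
∑-lin zero    a b f g = lemma a b
  where
  lemma : ∀ a b → 0ℤ ≡ a ℤ.* 0ℤ ℤ.+ b ℤ.* 0ℤ
  lemma = solve-∀
∑-lin (suc n) a b f g = trans (cong (λ t → t ℤ.+ (a ℤ.* f n ℤ.+ b ℤ.* g n)) (∑-lin n a b f g)) (lemma a b (∑ n f) (∑ n g) (f n) (g n))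
  where
  lemma : ∀ a b s t x y → a ℤ.* s ℤ.+ b ℤ.* t ℤ.+ (a ℤ.* x ℤ.+ b ℤ.* y) ≡ a ℤ.* (s ℤ.+ x) ℤ.+ b ℤ.* (t ℤ.+ y)
  lemma = solve-∀

∑-+ : ∀ n f g → ∑ n (λ r → f r ℤ.+ g r) ≡ ∑ n f ℤ.+ ∑ n g
∑-+ zero    f g = refl
∑-+ (suc n) f g = trans (cong (λ t → t ℤ.+ (f n ℤ.+ g n)) (∑-+ n f g)) (lemma (∑ n f) (∑ n g) (f n) (g n))
  where
  lemma : ∀ s t x y → s ℤ.+ t ℤ.+ (x ℤ.+ y) ≡ s ℤ.+ x ℤ.+ (t ℤ.+ y)
  lemma = solve-∀

∑-head : ∀ n f → ∑ (suc n) f ≡ f 0 ℤ.+ ∑ n (λ r → f (suc r))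
∑-head zero    f = ℤₚ.+-comm 0ℤ (f 0)
∑-head (suc n) f = trans (cong (λ t → t ℤ.+ f (suc n)) (∑-head n f)) (ℤₚ.+-assoc (f 0) _ _)

-- Made for commutators with a sum of operators, where a single term fails to commute. If that term
-- lies outside the range, its contribution y must be 0.
∑-pivot : ∀ n q {f g y} → (∀ r → r < n → r ≢ q → f r ≡ g r) → (q < n → f q ≡ g q ℤ.+ y) →
  (n ≤ q → y ≡ 0ℤ) → ∑ n f ≡ ∑ n g ℤ.+ y
∑-pivot zero    q off on out = sym (trans (ℤₚ.+-identityˡ _) (out z≤n))
∑-pivot (suc n) q {f} {g} {y} off on out with n ≟ q
... | yes refl = trans
  (cong₂ ℤ._+_ (∑-cong n (λ r r<n → off r (ℕₚ.m<n⇒m<1+n r<n) (ℕₚ.<⇒≢ r<n))) (on ℕₚ.≤-refl))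
  (sym (ℤₚ.+-assoc (∑ n g) (g n) y))
... | no n≢q = trans
  (cong₂ ℤ._+_
    (∑-pivot n q {f} {g} {y} (λ r r<n → off r (ℕₚ.m<n⇒m<1+n r<n)) (λ q<n → on (ℕₚ.m<n⇒m<1+n q<n))
       (λ n≤q → out (ℕₚ.≤∧≢⇒< n≤q n≢q)))
    (off n ℕₚ.≤-refl n≢q))
  (lemma (∑ n g) y (g n))
  where
  lemma : ∀ s y x → s ℤ.+ y ℤ.+ x ≡ s ℤ.+ x ℤ.+ y
  lemma = solve-∀

-- Summation by parts, with the boundary term kept so that induction on n goes through. The factor
-- (r + 1)(J - r) is the one whose differences are linear in r.
∑-abel : ∀ n (J : ℤ) (x : ℕ → ℤ) →
  ∑ n (λ r → + suc r ℤ.* (J ℤ.- + r) ℤ.* (x (suc r) ℤ.- x r)) ≡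
  ∑ n (λ r → (+ 2 ℤ.* + r ℤ.- J) ℤ.* x r) ℤ.+ + n ℤ.* (J ℤ.- + n ℤ.+ 1ℤ) ℤ.* x n
∑-abel zero    J x = refl
∑-abel (suc n) J x = trans
  (cong (λ t → t ℤ.+ + suc n ℤ.* (J ℤ.- + n) ℤ.* (x (suc n) ℤ.- x n)) (∑-abel n J x))
  (lemma (∑ n (λ r → (+ 2 ℤ.* + r ℤ.- J) ℤ.* x r)) J (+ n) (x n) (x (suc n)))
  where
  lemma : ∀ s J n x y →
    s ℤ.+ n ℤ.* (J ℤ.- n ℤ.+ 1ℤ) ℤ.* x ℤ.+ (1ℤ ℤ.+ n) ℤ.* (J ℤ.- n) ℤ.* (y ℤ.- x) ≡
    s ℤ.+ (+ 2 ℤ.* n ℤ.- J) ℤ.* x ℤ.+ (1ℤ ℤ.+ n) ℤ.* (J ℤ.- (1ℤ ℤ.+ n) ℤ.+ 1ℤ) ℤ.* y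
  lemma = solve-∀

∑-at : ∀ {m} (e : Vec ℕ m) a →
  ∑ m (λ r → (+ 2 ℤ.* + r ℤ.+ a) ℤ.* + at e r) ≡
  (a ℤ.+ + 2 ℤ.* (+ m ℤ.- 1ℤ)) ℤ.* + deg e ℤ.- + 2 ℤ.* + wt e
∑-at []      a = lemma a
  where
  lemma : ∀ a → 0ℤ ≡ (a ℤ.+ + 2 ℤ.* (0ℤ ℤ.- 1ℤ)) ℤ.* 0ℤ ℤ.- + 2 ℤ.* 0ℤ
  lemma = solve-∀
∑-at {suc m} (x ∷ e) a = begin
  ∑ (suc m) (λ r → (+ 2 ℤ.* + r ℤ.+ a) ℤ.* + at (x ∷ e) r)
    ≡⟨ ∑-head m (λ r → (+ 2 ℤ.* + r ℤ.+ a) ℤ.* + at (x ∷ e) r) ⟩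
  (0ℤ ℤ.+ a) ℤ.* + x ℤ.+ ∑ m (λ r → (+ 2 ℤ.* + suc r ℤ.+ a) ℤ.* + at e r)
    ≡⟨ cong (λ t → (0ℤ ℤ.+ a) ℤ.* + x ℤ.+ t) (∑-cong m (λ r _ → cong (ℤ._* + at e r) (lemma₁ (+ r) a))) ⟩
  (0ℤ ℤ.+ a) ℤ.* + x ℤ.+ ∑ m (λ r → (+ 2 ℤ.* + r ℤ.+ (a ℤ.+ + 2)) ℤ.* + at e r)
    ≡⟨ cong (λ t → (0ℤ ℤ.+ a) ℤ.* + x ℤ.+ t) (∑-at e (a ℤ.+ + 2)) ⟩
  (0ℤ ℤ.+ a) ℤ.* + x ℤ.+ ((a ℤ.+ + 2 ℤ.+ + 2 ℤ.* (+ m ℤ.- 1ℤ)) ℤ.* + deg e ℤ.- + 2 ℤ.* + wt e)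
    ≡⟨ lemma₂ a (+ x) (+ m) (+ deg e) (+ wt e) ⟩
  (a ℤ.+ + 2 ℤ.* (+ suc m ℤ.- 1ℤ)) ℤ.* (+ x ℤ.+ + deg e) ℤ.- + 2 ℤ.* (+ m ℤ.* + x ℤ.+ + wt e)
    ≡⟨ cong (λ t → (a ℤ.+ + 2 ℤ.* (+ suc m ℤ.- 1ℤ)) ℤ.* + (x + deg e) ℤ.- + 2 ℤ.* (t ℤ.+ + wt e)) (sym (ℤₚ.pos-* m x)) ⟩
  (a ℤ.+ + 2 ℤ.* (+ suc m ℤ.- 1ℤ)) ℤ.* + (x + deg e) ℤ.- + 2 ℤ.* + (m * x + wt e) ∎
  where
  open ≡-Reasoning
  lemma₁ : ∀ r a → + 2 ℤ.* (1ℤ ℤ.+ r) ℤ.+ a ≡ + 2 ℤ.* r ℤ.+ (a ℤ.+ + 2)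
  lemma₁ = solve-∀
  lemma₂ : ∀ a x m d w →
    (0ℤ ℤ.+ a) ℤ.* x ℤ.+ ((a ℤ.+ + 2 ℤ.+ + 2 ℤ.* (m ℤ.- 1ℤ)) ℤ.* d ℤ.- + 2 ℤ.* w) ≡
    (a ℤ.+ + 2 ℤ.* (1ℤ ℤ.+ m ℤ.- 1ℤ)) ℤ.* (x ℤ.+ d) ℤ.- + 2 ℤ.* (m ℤ.* x ℤ.+ w)
  lemma₂ = solve-∀

-- Collects the Leibniz expansion of a lowered quadric by its products: an inner product arises from
-- two neighbouring terms, each of the two outer ones from a single term.
∑-pascal : ∀ s (c : ℕ → ℤ) (x : ℕ → ℕ → ℤ) →
  ∑ (suc s) (λ p → c p ℤ.* (x (suc p) (s ∸ p) ℤ.+ x p (suc (s ∸ p)))) ≡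
  c 0 ℤ.* x 0 (suc s) ℤ.+ ∑ s (λ p → (c p ℤ.+ c (suc p)) ℤ.* x (suc p) (s ∸ p)) ℤ.+ c s ℤ.* x (suc s) 0
∑-pascal s c x = begin
  ∑ (suc s) (λ p → c p ℤ.* (x (suc p) (s ∸ p) ℤ.+ x p (suc (s ∸ p))))
    ≡⟨ ∑-cong (suc s) (λ p _ → ℤₚ.*-distribˡ-+ (c p) (x (suc p) (s ∸ p)) (x p (suc (s ∸ p)))) ⟩
  ∑ (suc s) (λ p → a p ℤ.+ c p ℤ.* x p (suc (s ∸ p)))
    ≡⟨ ∑-+ (suc s) a (λ p → c p ℤ.* x p (suc (s ∸ p))) ⟩
  ∑ s a ℤ.+ a s ℤ.+ ∑ (suc s) (λ p → c p ℤ.* x p (suc (s ∸ p)))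
    ≡⟨ cong₂ (λ t u → ∑ s a ℤ.+ c s ℤ.* x (suc s) t ℤ.+ u) (ℕₚ.n∸n≡0 s) (trans
         (∑-head s (λ p → c p ℤ.* x p (suc (s ∸ p))))
         (cong (λ t → c 0 ℤ.* x 0 (suc s) ℤ.+ t) (∑-cong s (λ p p<s →
           cong (λ t → c (suc p) ℤ.* x (suc p) t) (sym (ℕₚ.+-∸-assoc 1 p<s)))))) ⟩
  ∑ s a ℤ.+ c s ℤ.* x (suc s) 0 ℤ.+ (c 0 ℤ.* x 0 (suc s) ℤ.+ ∑ s b)
    ≡⟨ lemma (∑ s a) (c s ℤ.* x (suc s) 0) (c 0 ℤ.* x 0 (suc s)) (∑ s b) ⟩
  c 0 ℤ.* x 0 (suc s) ℤ.+ (∑ s a ℤ.+ ∑ s b) ℤ.+ c s ℤ.* x (suc s) 0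
    ≡⟨ cong (λ t → c 0 ℤ.* x 0 (suc s) ℤ.+ t ℤ.+ c s ℤ.* x (suc s) 0) (trans (sym (∑-+ s a b))
         (∑-cong s (λ p _ → sym (ℤₚ.*-distribʳ-+ (x (suc p) (s ∸ p)) (c p) (c (suc p)))))) ⟩
  c 0 ℤ.* x 0 (suc s) ℤ.+ ∑ s (λ p → (c p ℤ.+ c (suc p)) ℤ.* x (suc p) (s ∸ p)) ℤ.+ c s ℤ.* x (suc s) 0 ∎
  where
  open ≡-Reasoning
  a b : ℕ → ℤ
  a p = c p ℤ.* x (suc p) (s ∸ p)
  b p = c (suc p) ℤ.* x (suc p) (s ∸ p)
  lemma : ∀ a y z b → a ℤ.+ y ℤ.+ (z ℤ.+ b) ≡ z ℤ.+ (a ℤ.+ b) ℤ.+ y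
  lemma = solve-∀

+a*x≡0 : ∀ a {x} → (a ≢ 0 → x ≡ 0ℤ) → + a ℤ.* x ≡ 0ℤ
+a*x≡0 zero    _  = refl
+a*x≡0 (suc a) eq = trans (cong (λ t → + suc a ℤ.* t) (eq λ ())) (ℤₚ.*-zeroʳ (+ suc a))

homogeneous? : ∀ {m} o n i (e : Vec ℕ m) → Dec (Homogeneous o n i e)
homogeneous? o n i e with deg e ≟ n | o + wt e ≟ i
... | yes p | yes q = yes (p , q)
... | no ¬p | _     = no λ h → ¬p (Homogeneous.deg≡ h)
... | yes _ | no ¬q = no λ h → ¬q (Homogeneous.wt≡ h)

module Representation (j : ℕ) where

  Exp : Set
  Exp = Vec ℕ (suc j)

  -- A function v : Exp → ℤ stands for the polynomial Σ v(e) bᵉ / e!, so M p is multiplication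
  -- by b_p (zero for p > j) and ∂ p is the partial derivative with respect to b_p.
  infixr 9 _∙_
  infixr 8 _·_
  infixl 7 _⊹_

  data Op : Set where
    M ∂ : ℕ → Op
    I : Op
    _∙_ _⊹_ : Op → Op → Op
    _·_ : ℤ → Op → Op
    Sum : ℕ → (ℕ → Op) → Op

  ⟦_⟧ : Op → (Exp → ℤ) → Exp → ℤ
  ⟦ M p ⟧     v e = + at e p ℤ.* v (dec p e)
  ⟦ ∂ p ⟧     v e = v (inc p e)
  ⟦ I ⟧       v   = v
  ⟦ X ∙ Y ⟧   v   = ⟦ X ⟧ (⟦ Y ⟧ v)
  ⟦ X ⊹ Y ⟧   v e = ⟦ X ⟧ v e ℤ.+ ⟦ Y ⟧ v e
  ⟦ c · X ⟧   v e = c ℤ.* ⟦ X ⟧ v e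
  ⟦ Sum n X ⟧ v e = ∑ n (λ r → ⟦ X r ⟧ v e)

  ⟦⟧-ext : ∀ X {u v} → (∀ e → u e ≡ v e) → ∀ e → ⟦ X ⟧ u e ≡ ⟦ X ⟧ v e
  ⟦⟧-ext (M p)     eq e = cong (λ t → + at e p ℤ.* t) (eq (dec p e))
  ⟦⟧-ext (∂ p)     eq e = eq (inc p e)
  ⟦⟧-ext I         eq e = eq e
  ⟦⟧-ext (X ∙ Y)   eq e = ⟦⟧-ext X (⟦⟧-ext Y eq) e
  ⟦⟧-ext (X ⊹ Y)   eq e = cong₂ ℤ._+_ (⟦⟧-ext X eq e) (⟦⟧-ext Y eq e)
  ⟦⟧-ext (c · X)   eq e = cong (c ℤ.*_) (⟦⟧-ext X eq e)
  ⟦⟧-ext (Sum n X) eq e = ∑-cong n (λ r _ → ⟦⟧-ext (X r) eq e)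

  ⟦⟧-lin : ∀ X a b u v e →
    ⟦ X ⟧ (λ e → a ℤ.* u e ℤ.+ b ℤ.* v e) e ≡ a ℤ.* ⟦ X ⟧ u e ℤ.+ b ℤ.* ⟦ X ⟧ v e
  ⟦⟧-lin (M p)     a b u v e = lemma (+ at e p) a b (u (dec p e)) (v (dec p e))
    where
    lemma : ∀ c a b s t → c ℤ.* (a ℤ.* s ℤ.+ b ℤ.* t) ≡ a ℤ.* (c ℤ.* s) ℤ.+ b ℤ.* (c ℤ.* t)
    lemma = solve-∀
  ⟦⟧-lin (∂ p)     a b u v e = refl
  ⟦⟧-lin I         a b u v e = refl
  ⟦⟧-lin (X ∙ Y)   a b u v e = trans (⟦⟧-ext X (⟦⟧-lin Y a b u v) e) (⟦⟧-lin X a b (⟦ Y ⟧ u) (⟦ Y ⟧ v) e)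
  ⟦⟧-lin (X ⊹ Y)   a b u v e = trans (cong₂ ℤ._+_ (⟦⟧-lin X a b u v e) (⟦⟧-lin Y a b u v e))
    (lemma a b (⟦ X ⟧ u e) (⟦ X ⟧ v e) (⟦ Y ⟧ u e) (⟦ Y ⟧ v e))
    where
    lemma : ∀ a b s t s′ t′ → a ℤ.* s ℤ.+ b ℤ.* t ℤ.+ (a ℤ.* s′ ℤ.+ b ℤ.* t′) ≡ a ℤ.* (s ℤ.+ s′) ℤ.+ b ℤ.* (t ℤ.+ t′)
    lemma = solve-∀
  ⟦⟧-lin (c · X)   a b u v e = trans (cong (c ℤ.*_) (⟦⟧-lin X a b u v e)) (lemma c a b (⟦ X ⟧ u e) (⟦ X ⟧ v e))
    where
    lemma : ∀ c a b s t → c ℤ.* (a ℤ.* s ℤ.+ b ℤ.* t) ≡ a ℤ.* (c ℤ.* s) ℤ.+ b ℤ.* (c ℤ.* t)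
    lemma = solve-∀
  ⟦⟧-lin (Sum n X) a b u v e = trans (∑-cong n (λ r _ → ⟦⟧-lin (X r) a b u v e))
    (∑-lin n a b (λ r → ⟦ X r ⟧ u e) (λ r → ⟦ X r ⟧ v e))

  ⟦⟧-+ : ∀ X u v e → ⟦ X ⟧ (λ e → u e ℤ.+ v e) e ≡ ⟦ X ⟧ u e ℤ.+ ⟦ X ⟧ v e
  ⟦⟧-+ X u v e = trans
    (⟦⟧-ext X (λ e → cong₂ ℤ._+_ (sym (ℤₚ.*-identityˡ (u e))) (sym (ℤₚ.*-identityˡ (v e)))) e)
    (trans (⟦⟧-lin X 1ℤ 1ℤ u v e) (cong₂ ℤ._+_ (ℤₚ.*-identityˡ (⟦ X ⟧ u e)) (ℤₚ.*-identityˡ (⟦ X ⟧ v e))))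

  ⟦⟧-* : ∀ X c u e → ⟦ X ⟧ (λ e → c ℤ.* u e) e ≡ c ℤ.* ⟦ X ⟧ u e
  ⟦⟧-* X c u e = trans
    (⟦⟧-ext X (λ e → lemma c (u e)) e)
    (trans (⟦⟧-lin X c 0ℤ u u e) (sym (lemma c (⟦ X ⟧ u e))))
    where
    lemma : ∀ c s → c ℤ.* s ≡ c ℤ.* s ℤ.+ 0ℤ ℤ.* s
    lemma = solve-∀

  ⟦⟧-0 : ∀ X {v} → (∀ e → v e ≡ 0ℤ) → ∀ e → ⟦ X ⟧ v e ≡ 0ℤ
  ⟦⟧-0 X {v} eq e = trans
    (⟦⟧-ext X {v} {λ e → 0ℤ ℤ.* v e} (λ e → trans (eq e) (sym (ℤₚ.*-zeroˡ (v e)))) e)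
    (trans (⟦⟧-* X 0ℤ v e) (ℤₚ.*-zeroˡ (⟦ X ⟧ v e)))

  ⟦⟧-∑ : ∀ X n (g : ℕ → Exp → ℤ) e → ⟦ X ⟧ (λ e → ∑ n (λ r → g r e)) e ≡ ∑ n (λ r → ⟦ X ⟧ (g r) e)
  ⟦⟧-∑ X zero    g e = ⟦⟧-0 X (λ _ → refl) e
  ⟦⟧-∑ X (suc n) g e = trans
    (⟦⟧-+ X (λ e → ∑ n (λ r → g r e)) (g n) e)
    (cong (λ t → t ℤ.+ ⟦ X ⟧ (g n) e) (⟦⟧-∑ X n g e))

  M-beyond : ∀ {p} → j < p → ∀ v e → ⟦ M p ⟧ v e ≡ 0ℤ
  M-beyond {p} j<p v e = cong (λ a → + a ℤ.* v (dec p e)) (at-beyond e j<p)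

  MM-comm : ∀ p q v e → ⟦ M p ⟧ (⟦ M q ⟧ v) e ≡ ⟦ M q ⟧ (⟦ M p ⟧ v) e
  MM-comm p q v e with p ≟ q
  ... | yes refl = refl
  ... | no  p≢q
    rewrite at-dec-≢ e p q p≢q | at-dec-≢ e q p (λ q≡p → p≢q (sym q≡p)) | dec-comm p q e =
    lemma (+ at e p) (+ at e q) (v (dec q (dec p e)))
    where
    lemma : ∀ a b x → a ℤ.* (b ℤ.* x) ≡ b ℤ.* (a ℤ.* x)
    lemma = solve-∀

  ∂M-comm : ∀ p q → p ≢ q → ∀ v e → ⟦ ∂ p ⟧ (⟦ M q ⟧ v) e ≡ ⟦ M q ⟧ (⟦ ∂ p ⟧ v) e
  ∂M-comm p q p≢q v e rewrite at-inc-≢ e p q p≢q | dec-inc-comm p q e p≢q = refl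

  M∂ : ∀ p v e → ⟦ M p ⟧ (⟦ ∂ p ⟧ v) e ≡ + at e p ℤ.* v e
  M∂ p v e with at e p ≟ 0
  ... | yes at≡0 rewrite at≡0 = refl
  ... | no  at≢0 rewrite inc-dec p e at≢0 = refl

  ∂M : ∀ p → p ≤ j → ∀ v e → ⟦ ∂ p ⟧ (⟦ M p ⟧ v) e ≡ ⟦ M p ⟧ (⟦ ∂ p ⟧ v) e ℤ.+ v e
  ∂M p p≤j v e rewrite M∂ p v e | at-inc e p (s≤s p≤j) | dec-inc p e = lemma (+ at e p) (v e)
    where
    lemma : ∀ a x → (1ℤ ℤ.+ a) ℤ.* x ≡ a ℤ.* x ℤ.+ x
    lemma = solve-∀

  -- The action of sl₂ and its commutation relations

  lowering raising : Op
  lowering = Sum j (λ r → M (suc r) ∙ ∂ r)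
  raising  = Sum j (λ r → (+ suc r ℤ.* (+ j ℤ.- + r)) · (M r ∙ ∂ (suc r)))

  -- Y is the commutator [`lowering`, X]. Since commutators obey the Leibniz rule, those of
  -- composite operators are assembled from those of `M` and `∂`.
  record Derives (X Y : Op) : Set where
    field
      commutator : ∀ v e → ⟦ lowering ⟧ (⟦ X ⟧ v) e ≡ ⟦ X ⟧ (⟦ lowering ⟧ v) e ℤ.+ ⟦ Y ⟧ v e

  open Derives

  derives-M : ∀ q → Derives (M q) (M (suc q))
  derives-M q .commutator v e = trans
    (∑-pivot j q {g = λ r → ⟦ M q ⟧ (⟦ M (suc r) ⟧ (⟦ ∂ r ⟧ v)) e} off on
       (λ j≤q → M-beyond (s≤s j≤q) v e))
    (cong (λ t → t ℤ.+ ⟦ M (suc q) ⟧ v e) (sym (⟦⟧-∑ (M q) j (λ r → ⟦ M (suc r) ∙ ∂ r ⟧ v) e)))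
    where
    off : ∀ r → r < j → r ≢ q → ⟦ M (suc r) ⟧ (⟦ ∂ r ⟧ (⟦ M q ⟧ v)) e ≡ ⟦ M q ⟧ (⟦ M (suc r) ⟧ (⟦ ∂ r ⟧ v)) e
    off r _ r≢q = trans (⟦⟧-ext (M (suc r)) (∂M-comm r q r≢q v) e) (MM-comm (suc r) q (⟦ ∂ r ⟧ v) e)
    on : q < j → ⟦ M (suc q) ⟧ (⟦ ∂ q ⟧ (⟦ M q ⟧ v)) e ≡ ⟦ M q ⟧ (⟦ M (suc q) ⟧ (⟦ ∂ q ⟧ v)) e ℤ.+ ⟦ M (suc q) ⟧ v e
    on q<j = trans (⟦⟧-ext (M (suc q)) (∂M q (ℕₚ.<⇒≤ q<j) v) e)
      (trans (⟦⟧-+ (M (suc q)) (⟦ M q ⟧ (⟦ ∂ q ⟧ v)) v e)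
        (cong (λ t → t ℤ.+ ⟦ M (suc q) ⟧ v e) (MM-comm (suc q) q (⟦ ∂ q ⟧ v) e)))

  derives-∂ : ∀ q → q < j → Derives (∂ (suc q)) (-1ℤ · ∂ q)
  derives-∂ q q<j .commutator v e = trans
    (lemma (⟦ lowering ⟧ (⟦ ∂ (suc q) ⟧ v) e) (⟦ ∂ q ⟧ v e))
    -- Here the composite with `∂` outermost is the larger one, by `∂ q`, so `∑-pivot` is applied in
    -- the opposite direction and the surplus is moved across with a minus sign.
    (cong (λ t → t ℤ.+ -1ℤ ℤ.* ⟦ ∂ q ⟧ v e) (sym (∑-pivot j q off on (λ j≤q → contradiction q<j (ℕₚ.≤⇒≯ j≤q)))))
    where
    lemma : ∀ s x → s ≡ s ℤ.+ x ℤ.+ -1ℤ ℤ.* x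
    lemma = solve-∀
    swap : ∀ r → ⟦ M (suc r) ⟧ (⟦ ∂ (suc q) ⟧ (⟦ ∂ r ⟧ v)) e ≡ ⟦ M (suc r) ⟧ (⟦ ∂ r ⟧ (⟦ ∂ (suc q) ⟧ v)) e
    swap r = ⟦⟧-ext (M (suc r)) {⟦ ∂ (suc q) ⟧ (⟦ ∂ r ⟧ v)} {⟦ ∂ r ⟧ (⟦ ∂ (suc q) ⟧ v)} (λ e → cong v (inc-comm r (suc q) e)) e
    off : ∀ r → r < j → r ≢ q → ⟦ ∂ (suc q) ⟧ (⟦ M (suc r) ⟧ (⟦ ∂ r ⟧ v)) e ≡ ⟦ M (suc r) ⟧ (⟦ ∂ r ⟧ (⟦ ∂ (suc q) ⟧ v)) e
    off r _ r≢q = trans (∂M-comm (suc q) (suc r) (λ eq → r≢q (sym (ℕₚ.suc-injective eq))) (⟦ ∂ r ⟧ v) e) (swap r)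
    on : q < j → ⟦ ∂ (suc q) ⟧ (⟦ M (suc q) ⟧ (⟦ ∂ q ⟧ v)) e ≡ ⟦ M (suc q) ⟧ (⟦ ∂ q ⟧ (⟦ ∂ (suc q) ⟧ v)) e ℤ.+ ⟦ ∂ q ⟧ v e
    on _ = trans (∂M (suc q) q<j (⟦ ∂ q ⟧ v) e) (cong (λ t → t ℤ.+ ⟦ ∂ q ⟧ v e) (swap q))

  derives-∙ : ∀ {X X′ Y Y′} → Derives X X′ → Derives Y Y′ → Derives (X ∙ Y) (X′ ∙ Y ⊹ X ∙ Y′)
  derives-∙ {X} {X′} {Y} {Y′} dX dY .commutator v e = begin
    ⟦ lowering ⟧ (⟦ X ⟧ (⟦ Y ⟧ v)) e
      ≡⟨ commutator dX (⟦ Y ⟧ v) e ⟩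
    ⟦ X ⟧ (⟦ lowering ⟧ (⟦ Y ⟧ v)) e ℤ.+ ⟦ X′ ⟧ (⟦ Y ⟧ v) e
      ≡⟨ cong (λ t → t ℤ.+ ⟦ X′ ⟧ (⟦ Y ⟧ v) e) (trans (⟦⟧-ext X (commutator dY v) e) (⟦⟧-+ X (⟦ Y ⟧ (⟦ lowering ⟧ v)) (⟦ Y′ ⟧ v) e)) ⟩
    ⟦ X ⟧ (⟦ Y ⟧ (⟦ lowering ⟧ v)) e ℤ.+ ⟦ X ⟧ (⟦ Y′ ⟧ v) e ℤ.+ ⟦ X′ ⟧ (⟦ Y ⟧ v) e
      ≡⟨ lemma (⟦ X ⟧ (⟦ Y ⟧ (⟦ lowering ⟧ v)) e) (⟦ X ⟧ (⟦ Y′ ⟧ v) e) (⟦ X′ ⟧ (⟦ Y ⟧ v) e) ⟩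
    ⟦ X ⟧ (⟦ Y ⟧ (⟦ lowering ⟧ v)) e ℤ.+ (⟦ X′ ⟧ (⟦ Y ⟧ v) e ℤ.+ ⟦ X ⟧ (⟦ Y′ ⟧ v) e) ∎
    where
    open ≡-Reasoning
    lemma : ∀ s t x → s ℤ.+ t ℤ.+ x ≡ s ℤ.+ (x ℤ.+ t)
    lemma = solve-∀

  derives-· : ∀ c {X X′} → Derives X X′ → Derives (c · X) (c · X′)
  derives-· c {X} dX .commutator v e = trans
    (⟦⟧-* lowering c (⟦ X ⟧ v) e)
    (trans (cong (c ℤ.*_) (commutator dX v e)) (ℤₚ.*-distribˡ-+ c _ _))

  derives-Sum : ∀ n {X X′} → (∀ r → r < n → Derives (X r) (X′ r)) → Derives (Sum n X) (Sum n X′)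
  derives-Sum n {X} {X′} dX .commutator v e = trans
    (⟦⟧-∑ lowering n (λ r → ⟦ X r ⟧ v) e)
    (trans (∑-cong n (λ r r<n → commutator (dX r r<n) v e))
      (∑-+ n (λ r → ⟦ X r ⟧ (⟦ lowering ⟧ v) e) (λ r → ⟦ X′ r ⟧ v e)))

  -- The terms of the commutator are diagonal: (r + 1)(j - r)(x_{r+1} - x_r), with x_r the exponent
  -- of b_r. Summation by parts turns them into Σ (2r - j) x_r, where the boundary term supplies r =
  -- j, and this sum is j·deg - 2·wt.
  lowering-raising : ∀ v e → ⟦ lowering ⟧ (⟦ raising ⟧ v) e ≡
    ⟦ raising ⟧ (⟦ lowering ⟧ v) e ℤ.+ (+ j ℤ.* + deg e ℤ.- + 2 ℤ.* + wt e) ℤ.* v e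
  lowering-raising v e = trans
    (commutator (derives-Sum j (λ r r<j → derives-· (+ suc r ℤ.* (+ j ℤ.- + r)) (derives-∙ (derives-M r) (derives-∂ r r<j)))) v e)
    (cong (λ t → ⟦ raising ⟧ (⟦ lowering ⟧ v) e ℤ.+ t) weight)
    where
    open ≡-Reasoning
    x : ℕ → ℤ
    x r = + at e r
    lemma₁ : ∀ c a b y → c ℤ.* (a ℤ.* y ℤ.+ -1ℤ ℤ.* (b ℤ.* y)) ≡ y ℤ.* (c ℤ.* (a ℤ.- b)) ℤ.+ 0ℤ ℤ.* 0ℤ
    lemma₁ = solve-∀
    lemma₂ : ∀ s j y → s ℤ.+ j ℤ.* (j ℤ.- j ℤ.+ 1ℤ) ℤ.* y ≡ s ℤ.+ (+ 2 ℤ.* j ℤ.- j) ℤ.* y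
    lemma₂ = solve-∀
    lemma₃ : ∀ j y d w → y ℤ.* ((ℤ.- j ℤ.+ + 2 ℤ.* (1ℤ ℤ.+ j ℤ.- 1ℤ)) ℤ.* d ℤ.- + 2 ℤ.* w) ℤ.+ 0ℤ ℤ.* 0ℤ ≡ (j ℤ.* d ℤ.- + 2 ℤ.* w) ℤ.* y
    lemma₃ = solve-∀
    weight : ∑ j (λ r → + suc r ℤ.* (+ j ℤ.- + r) ℤ.* (⟦ M (suc r) ⟧ (⟦ ∂ (suc r) ⟧ v) e ℤ.+ ⟦ M r ⟧ (⟦ -1ℤ · ∂ r ⟧ v) e))
             ≡ (+ j ℤ.* + deg e ℤ.- + 2 ℤ.* + wt e) ℤ.* v e
    weight = begin
      ∑ j (λ r → + suc r ℤ.* (+ j ℤ.- + r) ℤ.* (⟦ M (suc r) ⟧ (⟦ ∂ (suc r) ⟧ v) e ℤ.+ ⟦ M r ⟧ (⟦ -1ℤ · ∂ r ⟧ v) e))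
        ≡⟨ ∑-cong j (λ r _ → trans
             (cong₂ (λ s t → + suc r ℤ.* (+ j ℤ.- + r) ℤ.* (s ℤ.+ t)) (M∂ (suc r) v e)
               (trans (⟦⟧-* (M r) -1ℤ (⟦ ∂ r ⟧ v) e) (cong (-1ℤ ℤ.*_) (M∂ r v e))))
             (lemma₁ (+ suc r ℤ.* (+ j ℤ.- + r)) (x (suc r)) (x r) (v e))) ⟩
      ∑ j (λ r → v e ℤ.* (+ suc r ℤ.* (+ j ℤ.- + r) ℤ.* (x (suc r) ℤ.- x r)) ℤ.+ 0ℤ ℤ.* 0ℤ)
        ≡⟨ ∑-lin j (v e) 0ℤ (λ r → + suc r ℤ.* (+ j ℤ.- + r) ℤ.* (x (suc r) ℤ.- x r)) (λ _ → 0ℤ) ⟩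
      v e ℤ.* ∑ j (λ r → + suc r ℤ.* (+ j ℤ.- + r) ℤ.* (x (suc r) ℤ.- x r)) ℤ.+ 0ℤ ℤ.* ∑ j (λ _ → 0ℤ)
        ≡⟨ cong₂ (λ s t → v e ℤ.* s ℤ.+ 0ℤ ℤ.* t)
             (trans (∑-abel j (+ j) x) (trans (lemma₂ (∑ j (λ r → (+ 2 ℤ.* + r ℤ.- + j) ℤ.* x r)) (+ j) (x j)) (∑-at e (ℤ.- + j))))
             (∑-zero j (λ _ _ → refl)) ⟩
      v e ℤ.* ((ℤ.- + j ℤ.+ + 2 ℤ.* (+ suc j ℤ.- 1ℤ)) ℤ.* + deg e ℤ.- + 2 ℤ.* + wt e) ℤ.+ 0ℤ ℤ.* 0ℤ
        ≡⟨ lemma₃ (+ j) (v e) (+ deg e) (+ wt e) ⟩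
      (+ j ℤ.* + deg e ℤ.- + 2 ℤ.* + wt e) ℤ.* v e ∎

  -- Weight spaces, and injectivity of raising below the middle

  record Supp (o n i : ℕ) (v : Exp → ℤ) : Set where
    field
      vanish : ∀ e → ¬ Homogeneous o n i e → v e ≡ 0ℤ

  open Supp

  deg-inc-suc : ∀ r (e : Exp) → r < j → deg (inc r e) ≡ deg (inc (suc r) e)
  deg-inc-suc r e r<j = trans (deg-inc r e (ℕₚ.m<n⇒m<1+n r<j)) (sym (deg-inc (suc r) e (s≤s r<j)))

  wt-inc-suc : ∀ r (e : Exp) → r < j → wt (inc r e) ≡ suc (wt (inc (suc r) e))
  wt-inc-suc r e r<j = ℕₚ.+-cancelˡ-≡ r _ _ (trans (wt-inc r e (ℕₚ.<⇒≤ r<j))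
    (trans (sym (wt-inc (suc r) e r<j)) (sym (ℕₚ.+-suc r (wt (inc (suc r) e))))))

  homogeneous-lower : ∀ {o n i} r (e : Exp) → r < j →
    Homogeneous o n (suc i) (inc r e) → Homogeneous o n i (inc (suc r) e)
  homogeneous-lower {o} r e r<j (deg≡ , wt≡) =
    trans (sym (deg-inc-suc r e r<j)) deg≡ ,
    ℕₚ.suc-injective (trans (sym (ℕₚ.+-suc o _)) (trans (cong (_+_ o) (sym (wt-inc-suc r e r<j))) wt≡))

  homogeneous-raise : ∀ {o n i} r (e : Exp) → r < j →
    Homogeneous o n i (inc (suc r) e) → Homogeneous o n (suc i) (inc r e)
  homogeneous-raise {o} r e r<j (deg≡ , wt≡) =
    trans (deg-inc-suc r e r<j) deg≡ ,
    trans (cong (_+_ o) (wt-inc-suc r e r<j)) (trans (ℕₚ.+-suc o _) (cong suc wt≡))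

  lowering-zero : ∀ {o n v} → Supp o n 0 v → ∀ e → ⟦ lowering ⟧ v e ≡ 0ℤ
  lowering-zero {o} sv e = ∑-zero j (λ r r<j → +a*x≡0 (at e (suc r)) (λ _ → vanish sv _ (λ h →
    contradiction (trans (sym (trans (cong (_+_ o) (wt-inc-suc r (dec (suc r) e) r<j)) (ℕₚ.+-suc o _))) (Homogeneous.wt≡ h)) λ ())))

  lowering-supp : ∀ {o n i v} → Supp o n (suc i) v → Supp o n i (⟦ lowering ⟧ v)
  lowering-supp {o} {n} {i} sv .vanish e ¬h = ∑-zero j (λ r r<j → +a*x≡0 (at e (suc r)) (λ at≢0 → vanish sv _ (λ h →
    ¬h (subst (Homogeneous o n i) (inc-dec (suc r) e at≢0) (homogeneous-lower r (dec (suc r) e) r<j h)))))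

  raising-supp : ∀ {o n i v} → Supp o n i v → Supp o n (suc i) (⟦ raising ⟧ v)
  raising-supp {o} {n} {i} sv .vanish e ¬h = ∑-zero j (λ r r<j → trans
    (cong (+ suc r ℤ.* (+ j ℤ.- + r) ℤ.*_) (+a*x≡0 (at e r) (λ at≢0 → vanish sv _ (λ h →
      ¬h (subst (Homogeneous o n (suc i)) (inc-dec r e at≢0) (homogeneous-raise r (dec r e) r<j h))))))
    (ℤₚ.*-zeroʳ (+ suc r ℤ.* (+ j ℤ.- + r))))

  -- With weights shifted by o, twice the middle of degree n is j·n + 2·o. Its distance from 2i is
  -- the eigenvalue h + 1, positive exactly below the middle.
  homogeneous-weight : ∀ {o n i h} (e : Exp) → Homogeneous o n i e → suc (i + i) + h ≡ j * n + (o + o) →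
    + j ℤ.* + deg e ℤ.- + 2 ℤ.* + wt e ≡ + suc h
  homogeneous-weight {o} {h = h} e (refl , refl) eq = begin
    + j ℤ.* + deg e ℤ.- + 2 ℤ.* + wt e
      ≡⟨ lemma₁ (+ j ℤ.* + deg e) (+ wt e) (+ o) ⟩
    + j ℤ.* + deg e ℤ.+ (+ o ℤ.+ + o) ℤ.- (+ (o + wt e) ℤ.+ + (o + wt e))
      ≡⟨ cong (λ t → t ℤ.+ (+ o ℤ.+ + o) ℤ.- (+ (o + wt e) ℤ.+ + (o + wt e))) (sym (ℤₚ.pos-* j (deg e))) ⟩
    + (j * deg e + (o + o)) ℤ.- (+ (o + wt e) ℤ.+ + (o + wt e))
      ≡⟨ cong (λ t → + t ℤ.- (+ (o + wt e) ℤ.+ + (o + wt e))) (sym eq) ⟩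
    (1ℤ ℤ.+ (+ (o + wt e) ℤ.+ + (o + wt e)) ℤ.+ + h) ℤ.- (+ (o + wt e) ℤ.+ + (o + wt e))
      ≡⟨ lemma₂ (+ (o + wt e)) (+ h) ⟩
    + suc h ∎
    where
    open ≡-Reasoning
    lemma₁ : ∀ d w o → d ℤ.- + 2 ℤ.* w ≡ d ℤ.+ (o ℤ.+ o) ℤ.- ((o ℤ.+ w) ℤ.+ (o ℤ.+ w))
    lemma₁ = solve-∀
    lemma₂ : ∀ i h → (1ℤ ℤ.+ (i ℤ.+ i) ℤ.+ h) ℤ.- (i ℤ.+ i) ≡ 1ℤ ℤ.+ h
    lemma₂ = solve-∀

  -- On the weight space of weight h > 0 one has lowering ∘ raising = raising ∘ lowering + h,
  -- so lowering maps a (−c)-eigenvector of lowering ∘ raising to a (−c − h)-eigenvector of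
  -- smaller wt, which vanishes by induction; then the eigenvalue is also h.
  eigenvector-zero : ∀ {o n} i c {v} → Supp o n i v → i + i < j * n + (o + o) →
    (∀ e → ⟦ lowering ⟧ (⟦ raising ⟧ v) e ≡ ℤ.- + c ℤ.* v e) → ∀ e → v e ≡ 0ℤ
  eigenvector-zero {o} {n} i c {v} sv 2i<N eigen with ℕₚ.m≤n⇒∃[o]m+o≡n 2i<N
  ... | h , eq = λ e → x*y≡0⇒y≡0 (+ suc (c + h)) {v e} (λ ()) (trans
      (lemma₁ (+ c) (+ h) (v e))
      (trans (cong (λ t → + suc h ℤ.* v e ℤ.- t) (trans (sym (eigen e)) (trans (commute e) (trans
        (cong (λ t → t ℤ.+ + suc h ℤ.* v e) (⟦⟧-0 raising (lowered-zero i sv 2i<N) e))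
        (ℤₚ.+-identityˡ (+ suc h ℤ.* v e))))))
      (ℤₚ.+-inverseʳ (+ suc h ℤ.* v e))))
    where
    lemma₁ : ∀ c h x → (1ℤ ℤ.+ (c ℤ.+ h)) ℤ.* x ≡ (1ℤ ℤ.+ h) ℤ.* x ℤ.- (ℤ.- c ℤ.* x)
    lemma₁ = solve-∀
    commute : ∀ e → ⟦ lowering ⟧ (⟦ raising ⟧ v) e ≡ ⟦ raising ⟧ (⟦ lowering ⟧ v) e ℤ.+ + suc h ℤ.* v e
    commute e = trans (lowering-raising v e) (cong (λ t → ⟦ raising ⟧ (⟦ lowering ⟧ v) e ℤ.+ t) weight)
      where
      weight : (+ j ℤ.* + deg e ℤ.- + 2 ℤ.* + wt e) ℤ.* v e ≡ + suc h ℤ.* v e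
      weight with homogeneous? o n i e
      ... | yes hom = cong (ℤ._* v e) (homogeneous-weight e hom eq)
      ... | no ¬hom rewrite vanish sv e ¬hom = trans (ℤₚ.*-zeroʳ (+ j ℤ.* + deg e ℤ.- + 2 ℤ.* + wt e)) (sym (ℤₚ.*-zeroʳ (+ suc h)))
    lowered-eigen : ∀ e → ⟦ lowering ⟧ (⟦ raising ⟧ (⟦ lowering ⟧ v)) e ≡ ℤ.- + (c + suc h) ℤ.* ⟦ lowering ⟧ v e
    lowered-eigen e = trans
      (⟦⟧-ext lowering (λ e → trans (lemma₂ (⟦ raising ⟧ (⟦ lowering ⟧ v) e) (+ suc h) (v e)) (trans
        (cong (λ t → t ℤ.- + suc h ℤ.* v e) (trans (sym (commute e)) (eigen e)))
        (lemma₃ (+ c) (+ suc h) (v e)))) e)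
      (⟦⟧-* lowering (ℤ.- + (c + suc h)) v e)
      where
      lemma₂ : ∀ s h x → s ≡ s ℤ.+ h ℤ.* x ℤ.- h ℤ.* x
      lemma₂ = solve-∀
      lemma₃ : ∀ c h x → ℤ.- c ℤ.* x ℤ.- h ℤ.* x ≡ ℤ.- (c ℤ.+ h) ℤ.* x
      lemma₃ = solve-∀
    lowered-zero : ∀ i → Supp o n i v → i + i < j * n + (o + o) → ∀ e → ⟦ lowering ⟧ v e ≡ 0ℤ
    lowered-zero zero     sv _    = lowering-zero sv
    lowered-zero (suc i′) sv 2i<N = eigenvector-zero i′ (c + suc h) (lowering-supp sv)
      (ℕₚ.<-trans (s≤s (ℕₚ.+-monoʳ-≤ i′ (ℕₚ.n≤1+n i′))) 2i<N) lowered-eigen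

  lowering-raising-injective : ∀ {o n} i {v} → Supp o n i v → i + i < j * n + (o + o) →
    (∀ e → ⟦ lowering ⟧ (⟦ raising ⟧ v) e ≡ 0ℤ) → ∀ e → v e ≡ 0ℤ
  lowering-raising-injective i {v} sv 2i<N eq = eigenvector-zero i 0 sv 2i<N (λ e → trans (eq e) (sym (ℤₚ.*-zeroˡ (v e))))

  -- The weight w passes from the offset into the polynomial, so the total i stays fixed. Source and
  -- target are then indexed by the same power of q.
  record Graded (d w : ℕ) (X : Op) : Set where
    field
      supports : ∀ {o n i v} → Supp (o + w) n i v → Supp o (d + n) i (⟦ X ⟧ v)

  open Graded

  graded-zero : ∀ {d w X} → (∀ v e → ⟦ X ⟧ v e ≡ 0ℤ) → Graded d w X
  graded-zero X≡0 .supports _ .vanish e _ = X≡0 _ e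

  graded-M : ∀ p w → p + w ≡ j → Graded 1 w (M p)
  graded-M p w p+w≡j .supports {o} {n} {i} {v} sv .vanish e ¬h = +a*x≡0 (at e p) (λ at≢0 → vanish sv (dec p e) (λ (deg≡ , wt≡) →
    ¬h (subst (Homogeneous o (suc n) i) (inc-dec p e at≢0)
      ( trans (deg-inc p (dec p e) (s≤s p≤j)) (cong suc deg≡)
      , trans (cong (_+_ o) wt-inc′) (trans (sym (ℕₚ.+-assoc o w _)) wt≡)))))
    where
    p≤j : p ≤ j
    p≤j = subst (p ≤_) p+w≡j (ℕₚ.m≤m+n p w)
    wt-inc′ : wt (inc p (dec p e)) ≡ w + wt (dec p e)
    wt-inc′ = ℕₚ.+-cancelˡ-≡ p _ _ (trans (wt-inc p (dec p e) p≤j)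
      (trans (cong (λ t → t + wt (dec p e)) (sym p+w≡j)) (ℕₚ.+-assoc p w _)))

  graded-I : Graded 0 0 I
  graded-I .supports {o} {n} {i} {v} sv = subst (λ o → Supp o n i v) (ℕₚ.+-identityʳ o) sv

  graded-∙ : ∀ {d d′ w w′ X Y} → Graded d w X → Graded d′ w′ Y → Graded (d + d′) (w + w′) (X ∙ Y)
  graded-∙ {d} {d′} {w} {w′} {X} {Y} gX gY .supports {o} {n} {i} {v} sv =
    subst (λ n → Supp o n i (⟦ X ⟧ (⟦ Y ⟧ v))) (sym (ℕₚ.+-assoc d d′ n))
      (supports gX (supports gY (subst (λ o → Supp o n i v) (sym (ℕₚ.+-assoc o w w′)) sv)))

  graded-⊹ : ∀ {d w X Y} → Graded d w X → Graded d w Y → Graded d w (X ⊹ Y)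
  graded-⊹ gX gY .supports sv .vanish e ¬h = cong₂ ℤ._+_ (vanish (supports gX sv) e ¬h) (vanish (supports gY sv) e ¬h)

  graded-· : ∀ {d w X} c → Graded d w X → Graded d w (c · X)
  graded-· c gX .supports sv .vanish e ¬h = trans (cong (c ℤ.*_) (vanish (supports gX sv) e ¬h)) (ℤₚ.*-zeroʳ c)

  graded-Sum : ∀ {d w} n {X} → (∀ r → r < n → Graded d w (X r)) → Graded d w (Sum n X)
  graded-Sum n gX .supports sv .vanish e ¬h = ∑-zero n (λ r r<n → vanish (supports (gX r r<n) sv) e ¬h)

  graded-MM : ∀ p q w → p + q + w ≡ j + j → Graded 2 w (M p ∙ M q)
  graded-MM p q w eq with p ≤? j | q ≤? j
  ... | no  p≰j | _       = graded-zero (λ v e → M-beyond (ℕₚ.≰⇒> p≰j) (⟦ M q ⟧ v) e)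
  ... | yes _   | no  q≰j = graded-zero (λ v e → ⟦⟧-0 (M p) (M-beyond (ℕₚ.≰⇒> q≰j) v) e)
  ... | yes p≤j | yes q≤j = subst (λ w → Graded 2 w (M p ∙ M q)) w≡
    (graded-∙ (graded-M p (j ∸ p) (ℕₚ.m+[n∸m]≡n p≤j)) (graded-M q (j ∸ q) (ℕₚ.m+[n∸m]≡n q≤j)))
    where
    lemma : ∀ p q x y → p + q + (x + y) ≡ (p + x) + (q + y)
    lemma = ℕ-Solver.solve-∀
    w≡ : (j ∸ p) + (j ∸ q) ≡ w
    w≡ = ℕₚ.+-cancelˡ-≡ (p + q) _ _ (trans (lemma p q (j ∸ p) (j ∸ q))
      (trans (cong₂ _+_ (ℕₚ.m+[n∸m]≡n p≤j) (ℕₚ.m+[n∸m]≡n q≤j)) (sym eq)))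

  -- Quadrics of fixed index sum

  Quad : (ℕ → ℤ) → ℕ → Op
  Quad c s = Sum (suc s) (λ p → c p · (M p ∙ M (s ∸ p)))

  graded-Quad : ∀ c s w → s + w ≡ j + j → Graded 2 w (Quad c s)
  graded-Quad c s w eq = graded-Sum (suc s) (λ p p<1+s → graded-· (c p)
    (graded-MM p (s ∸ p) w (trans (cong (λ t → t + w) (ℕₚ.m+[n∸m]≡n (s≤s⁻¹ p<1+s))) eq)))

  Commute : Op → Op → Set
  Commute X Y = ∀ v e → ⟦ X ⟧ (⟦ Y ⟧ v) e ≡ ⟦ Y ⟧ (⟦ X ⟧ v) e

  commute-∙ : ∀ X Y Z → Commute X Y → Commute X Z → Commute X (Y ∙ Z)
  commute-∙ X Y Z XY XZ v e = trans (XY (⟦ Z ⟧ v) e) (⟦⟧-ext Y (XZ v) e)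

  commute-· : ∀ X c Y → Commute X Y → Commute X (c · Y)
  commute-· X c Y XY v e = trans (⟦⟧-* X c (⟦ Y ⟧ v) e) (cong (c ℤ.*_) (XY v e))

  commute-Sum : ∀ X n Y → (∀ r → Commute X (Y r)) → Commute X (Sum n Y)
  commute-Sum X n Y XY v e = trans (⟦⟧-∑ X n (λ r → ⟦ Y r ⟧ v) e) (∑-cong n (λ r _ → XY r v e))

  commute-sym : ∀ X Y → Commute X Y → Commute Y X
  commute-sym X Y XY v e = sym (XY v e)

  commute-Quad : ∀ X c s → (∀ p → Commute X (M p)) → Commute X (Quad c s)
  commute-Quad X c s XM = commute-Sum X (suc s) (λ p → c p · (M p ∙ M (s ∸ p))) (λ p → commute-· X (c p) (M p ∙ M (s ∸ p))
    (commute-∙ X (M p) (M (s ∸ p)) (XM p) (XM (s ∸ p))))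

  Quad-comm : ∀ c s c′ s′ → Commute (Quad c s) (Quad c′ s′)
  Quad-comm c s c′ s′ = commute-Quad (Quad c s) c′ s′ (λ q →
    commute-sym (M q) (Quad c s) (commute-Quad (M q) c s (λ p → MM-comm q p)))

  lowering-Quad : ∀ c s v e → ⟦ lowering ⟧ (⟦ Quad c s ⟧ v) e ≡ ⟦ Quad c s ⟧ (⟦ lowering ⟧ v) e ℤ.+
    (c 0 ℤ.* ⟦ M 0 ∙ M (suc s) ⟧ v e
     ℤ.+ ∑ s (λ p → (c p ℤ.+ c (suc p)) ℤ.* ⟦ M (suc p) ∙ M (s ∸ p) ⟧ v e)
     ℤ.+ c s ℤ.* ⟦ M (suc s) ∙ M 0 ⟧ v e)
  lowering-Quad c s v e = trans
    (commutator (derives-Sum (suc s) (λ p _ → derives-· (c p) (derives-∙ (derives-M p) (derives-M (s ∸ p))))) v e)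
    (cong (λ t → ⟦ Quad c s ⟧ (⟦ lowering ⟧ v) e ℤ.+ t) (∑-pascal s c (λ p q → ⟦ M p ∙ M q ⟧ v e)))

  -- Both outer products contain b_{s+1}, which is 0 once s ≥ j.
  lowering-Quad-beyond : ∀ c s → j ≤ s → ∀ v e → ⟦ lowering ⟧ (⟦ Quad c s ⟧ v) e ≡ ⟦ Quad c s ⟧ (⟦ lowering ⟧ v) e ℤ.+
    ∑ s (λ p → (c p ℤ.+ c (suc p)) ℤ.* ⟦ M (suc p) ∙ M (s ∸ p) ⟧ v e)
  lowering-Quad-beyond c s j≤s v e = trans (lowering-Quad c s v e) (cong (λ t → ⟦ Quad c s ⟧ (⟦ lowering ⟧ v) e ℤ.+ t)
    (trans (cong₂ (λ t u → c 0 ℤ.* t ℤ.+ S ℤ.+ c s ℤ.* u)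
             (⟦⟧-0 (M 0) (M-beyond (s≤s j≤s) v) e) (M-beyond (s≤s j≤s) (⟦ M 0 ⟧ v) e))
           (lemma (c 0) S (c s))))
    where
    S : ℤ
    S = ∑ s (λ p → (c p ℤ.+ c (suc p)) ℤ.* ⟦ M (suc p) ∙ M (s ∸ p) ⟧ v e)
    lemma : ∀ a s b → a ℤ.* 0ℤ ℤ.+ s ℤ.+ b ℤ.* 0ℤ ≡ s
    lemma = solve-∀

  -- Injectivity of multiplication, by the degree in b₀

  VanishFrom : ℕ → (Exp → ℤ) → Set
  VanishFrom d v = ∀ e → d ≤ at e 0 → v e ≡ 0ℤ

  supp⇒vanishFrom : ∀ {o n i v} → Supp o n i v → VanishFrom (suc n) v
  supp⇒vanishFrom sv e n<at = vanish sv e (λ { (refl , _) → ℕₚ.<⇒≱ n<at (at-0≤deg e) })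

  vanishFrom-M-suc : ∀ {d v} p → VanishFrom d v → VanishFrom d (⟦ M (suc p) ⟧ v)
  vanishFrom-M-suc {d} p z e d≤ = trans
    (cong (+ at e (suc p) ℤ.*_) (z (dec (suc p) e) (subst (d ≤_) (sym (at-dec-≢ e (suc p) 0 λ ())) d≤)))
    (ℤₚ.*-zeroʳ (+ at e (suc p)))

  vanishFrom-M : ∀ {d v} p → VanishFrom d v → VanishFrom (suc d) (⟦ M p ⟧ v)
  vanishFrom-M {d} zero z e d< = trans
    (cong (+ at e 0 ℤ.*_) (z (dec 0 e) (subst (d ≤_) (sym (at-dec-0 e)) (ℕₚ.pred-mono-≤ d<))))
    (ℤₚ.*-zeroʳ (+ at e 0))
  vanishFrom-M (suc p) z e d< = vanishFrom-M-suc p z e (ℕₚ.<⇒≤ d<)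

  -- The index sum is positive, so no term contains b₀² and the degree in b₀ grows by at most one.
  vanishFrom-Quad : ∀ {d v} c s → VanishFrom d v → VanishFrom (suc d) (⟦ Quad c (suc s) ⟧ v)
  vanishFrom-Quad {d} {v} c s z e d< = ∑-zero (suc (suc s)) (λ p _ → trans (cong (c p ℤ.*_) (term p)) (ℤₚ.*-zeroʳ (c p)))
    where
    term : ∀ p → ⟦ M p ∙ M (suc s ∸ p) ⟧ v e ≡ 0ℤ
    term zero    = vanishFrom-M 0 (vanishFrom-M-suc s z) e d<
    term (suc p) = vanishFrom-M-suc p (vanishFrom-M (s ∸ p) z) e d<

  -- With index sum j + 1 the partner of b₀ would be b_{j+1} = 0, so such a quadric is free of b₀.
  vanishFrom-Quad-suc-j : ∀ {d v} c → VanishFrom d v → VanishFrom d (⟦ Quad c (suc j) ⟧ v)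
  vanishFrom-Quad-suc-j {d} {v} c z e d≤ = ∑-zero (suc (suc j)) (λ p p≤ → trans (cong (c p ℤ.*_) (term p (s≤s⁻¹ p≤))) (ℤₚ.*-zeroʳ (c p)))
    where
    term : ∀ p → p ≤ suc j → ⟦ M p ∙ M (suc j ∸ p) ⟧ v e ≡ 0ℤ
    term zero    _ = ⟦⟧-0 (M 0) (M-beyond ℕₚ.≤-refl v) e
    term (suc p) (s≤s p≤j) with j ∸ p in eq
    ... | zero  = M-beyond (s≤s (ℕₚ.m∸n≡0⇒m≤n eq)) (⟦ M 0 ⟧ v) e
    ... | suc q = vanishFrom-M-suc p (vanishFrom-M-suc q z) e d≤

  -- The monomial b₀ b_j is the only one of a quadric of weight j that involves b₀, so it alone
  -- contributes to the coefficients of maximal b₀-degree.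
  Quad-descent : ∀ {d v} c → 1 ≤ j → c 0 ℤ.+ c j ≢ 0ℤ → VanishFrom (suc d) v →
    VanishFrom (suc d) (⟦ Quad c j ⟧ v) → VanishFrom d v
  Quad-descent {d} {v} c 1≤j κ≢0 z Qz e d≤ =
    x*y≡0⇒y≡0 (+ suc (at e j)) (λ ()) (x*y≡0⇒y≡0 (+ suc (at e 0)) (λ ()) (x*y≡0⇒y≡0 (c 0 ℤ.+ c j) κ≢0
      (trans (sym (trans (top 1≤j) (cong ((c 0 ℤ.+ c j) ℤ.*_) leading))) (Qz e′ (subst (suc d ≤_) (sym at0) (s≤s d≤))))))
    where
    e′ : Exp
    e′ = inc 0 (inc j e)
    0≢j : 0 ≢ j
    0≢j = ℕₚ.<⇒≢ 1≤j
    at0 : at e′ 0 ≡ suc (at e 0)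
    at0 = trans (at-inc (inc j e) 0 (s≤s z≤n)) (cong suc (at-inc-≢ e j 0 (λ j≡0 → 0≢j (sym j≡0))))
    leading : ⟦ M 0 ∙ M j ⟧ v e′ ≡ + suc (at e 0) ℤ.* (+ suc (at e j) ℤ.* v e)
    leading rewrite at0 | dec-inc 0 (inc j e) | at-inc e j ℕₚ.≤-refl | dec-inc j e = refl
    top : 1 ≤ j → ⟦ Quad c j ⟧ v e′ ≡ (c 0 ℤ.+ c j) ℤ.* ⟦ M 0 ∙ M j ⟧ v e′
    top (s≤s {n = t} _) = trans (cong (λ x → x ℤ.+ c j ℤ.* ⟦ M j ∙ M (j ∸ j) ⟧ v e′) (∑-head t (λ p → c p ℤ.* ⟦ M p ∙ M (j ∸ p) ⟧ v e′)))
      (trans (cong₂ (λ x y → c 0 ℤ.* ⟦ M 0 ∙ M j ⟧ v e′ ℤ.+ x ℤ.+ c j ℤ.* y)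
         (∑-zero t (λ p p<t → trans (cong (c (suc p) ℤ.*_) (middle p p<t)) (ℤₚ.*-zeroʳ (c (suc p)))))
         (trans (cong (λ x → ⟦ M j ∙ M x ⟧ v e′) (ℕₚ.n∸n≡0 j)) (MM-comm j 0 v e′)))
       (lemma (c 0) (c j) (⟦ M 0 ∙ M j ⟧ v e′)))
      where
      lemma : ∀ a b x → a ℤ.* x ℤ.+ 0ℤ ℤ.+ b ℤ.* x ≡ (a ℤ.+ b) ℤ.* x
      lemma = solve-∀
      middle : ∀ p → p < t → ⟦ M (suc p) ∙ M (t ∸ p) ⟧ v e′ ≡ 0ℤ
      middle p p<t rewrite ℕₚ.+-∸-assoc 1 p<t =
        vanishFrom-M-suc p (vanishFrom-M-suc (t ∸ suc p) z) e′ (subst (suc d ≤_) (sym at0) (s≤s d≤))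

  -- Invariants of degree 2(j - 1)

  record Invariant (d w : ℕ) : Set where
    field
      op        : Op
      gradedOp  : Graded d w op
      commutes  : Commute lowering op
      injective : ∀ {o n i v} → Supp o n i v → (∀ e → ⟦ op ⟧ v e ≡ 0ℤ) → ∀ e → v e ≡ 0ℤ

  open Invariant

  invariant-∙ : ∀ {d d′ w w′} → Invariant d w → Invariant d′ w′ → Invariant (d + d′) (w + w′)
  invariant-∙ X Y .op = op X ∙ op Y
  invariant-∙ X Y .gradedOp = graded-∙ (gradedOp X) (gradedOp Y)
  invariant-∙ X Y .commutes = commute-∙ lowering (op X) (op Y) (commutes X) (commutes Y)
  invariant-∙ {d′ = d′} {w′ = w′} X Y .injective {o} {n} {i} {v} sv eq =
    injective Y sv (injective X (supports (gradedOp Y) sv+w′) eq)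
    where
    lemma : ∀ o w x → o + w + x ≡ o + x + w
    lemma = ℕ-Solver.solve-∀
    -- Raising offset and total together by w′ describes the same weight space; in this form the
    -- grading of the right factor applies.
    sv+w′ : Supp (o + w′) n (i + w′) v
    sv+w′ .vanish e ¬h = vanish sv e (λ (deg≡ , wt≡) →
      ¬h (deg≡ , trans (lemma o w′ (wt e)) (cong (λ t → t + w′) wt≡)))

  invariant-^ : ∀ {d w} → Invariant d w → ∀ t → Invariant (t * d) (t * w)
  invariant-^ X zero    = record
    { op = I ; gradedOp = graded-I ; commutes = λ _ _ → refl ; injective = λ _ eq → eq }
  invariant-^ X (suc t) = invariant-∙ X (invariant-^ X t)

  -- Takes the place of the fact that a polynomial ring is a domain: if the top coefficient in b₀
  -- can always be shown to vanish, nothing remains.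
  vanishFrom-descent : ∀ {v} n → (∀ d → VanishFrom (suc d) v → VanishFrom d v) → VanishFrom n v → ∀ e → v e ≡ 0ℤ
  vanishFrom-descent zero    step z e = z e z≤n
  vanishFrom-descent (suc n) step z   = vanishFrom-descent n step (step n z)

  sgn : ℕ → ℤ
  sgn zero    = 1ℤ
  sgn (suc p) = ℤ.- sgn p

  sgn-Quad-commutes : ∀ s → j ≤ s → Commute lowering (Quad sgn s)
  sgn-Quad-commutes s j≤s v e = trans (lowering-Quad-beyond sgn s j≤s v e) (trans
    (cong (λ t → ⟦ Quad sgn s ⟧ (⟦ lowering ⟧ v) e ℤ.+ t) (∑-zero s (λ p _ →
      trans (cong (ℤ._* ⟦ M (suc p) ∙ M (s ∸ p) ⟧ v e) (ℤₚ.+-inverseʳ (sgn p))) (ℤₚ.*-zeroˡ (⟦ M (suc p) ∙ M (s ∸ p) ⟧ v e)))))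
    (ℤₚ.+-identityʳ _))

  -- Neighbouring signs cancel under `lowering`. The coefficient of b₀ b_j is 1 + (-1)^j = 2; for
  -- odd j the terms p and j - p cancel and the quadric is zero, which forces the passage to degree
  -- 4.
  quadraticInvariant : 1 ≤ j → sgn j ≡ 1ℤ → Invariant 2 j
  quadraticInvariant 1≤j even = record
    { op        = Quad sgn j
    ; gradedOp  = graded-Quad sgn j j refl
    ; commutes  = sgn-Quad-commutes j ℕₚ.≤-refl
    ; injective = λ {_} {n} sv eq → vanishFrom-descent (suc n)
        (λ d z → Quad-descent sgn 1≤j (λ κ≡0 → contradiction (trans (sym (cong (λ s → 1ℤ ℤ.+ s) even)) κ≡0) λ ()) z (λ e _ → eq e))
        (supp⇒vanishFrom sv)
    }

  -- 𝓒 x² + 𝓑 x y − 𝓐 y² is, up to scaling, the quadratic covariant of a binary form of odd degree j,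
  -- and 𝓑² + 4 𝓐 𝓒 its discriminant.
  module _ {t : ℕ} (j≡ : j ≡ suc (suc t)) (odd : sgn j ≡ -1ℤ) where

    -- Solutions of b_p + b_{p+1} = -2·(-1)^{p+1} and c_p + c_{p+1} = b_{p+1}, the equations that
    -- make `lowering` send 𝓒 to 𝓑 and 𝓑 to -2𝓐. For odd j they are symmetric under p ↦ j - p and p
    -- ↦ j - 1 - p, so the quadrics do not cancel.
    b c : ℕ → ℤ
    b p = sgn p ℤ.* (+ j ℤ.- + 2 ℤ.* + p)
    c p = sgn p ℤ.* ((+ p ℤ.+ 1ℤ) ℤ.* (+ j ℤ.- + p))

    𝓐 𝓑 𝓒 : Op
    𝓐 = Quad sgn (suc j)
    𝓑 = Quad b j
    𝓒 = Quad c (suc t)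

    lowering-𝓑 : ∀ v e → ⟦ lowering ⟧ (⟦ 𝓑 ⟧ v) e ≡ ⟦ 𝓑 ⟧ (⟦ lowering ⟧ v) e ℤ.+ (ℤ.- + 2) ℤ.* ⟦ 𝓐 ⟧ v e
    lowering-𝓑 v e = trans (lowering-Quad-beyond b j ℕₚ.≤-refl v e)
      (cong (λ x → ⟦ 𝓑 ⟧ (⟦ lowering ⟧ v) e ℤ.+ x) (trans
        (∑-cong j (λ p _ → lemma (sgn p) (+ j) (+ p) (x p)))
        (trans (∑-lin j (ℤ.- + 2) 0ℤ (λ p → ℤ.- sgn p ℤ.* x p) (λ _ → 0ℤ)) (trans (lemma′ (∑ j (λ p → ℤ.- sgn p ℤ.* x p)) (∑ j (λ _ → 0ℤ)))
        (cong ((ℤ.- + 2) ℤ.*_) (sym 𝓐≡))))))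
      where
      x : ℕ → ℤ
      x p = ⟦ M (suc p) ∙ M (j ∸ p) ⟧ v e
      lemma : ∀ s j p x → (s ℤ.* (j ℤ.- + 2 ℤ.* p) ℤ.+ ℤ.- s ℤ.* (j ℤ.- + 2 ℤ.* (1ℤ ℤ.+ p))) ℤ.* x ≡
        (ℤ.- + 2) ℤ.* (ℤ.- s ℤ.* x) ℤ.+ 0ℤ ℤ.* 0ℤ
      lemma = solve-∀
      lemma′ : ∀ s t → (ℤ.- + 2) ℤ.* s ℤ.+ 0ℤ ℤ.* t ≡ (ℤ.- + 2) ℤ.* s
      lemma′ = solve-∀
      lemma″ : ∀ a b c → a ℤ.* 0ℤ ℤ.+ b ℤ.+ c ℤ.* 0ℤ ≡ b
      lemma″ = solve-∀
      𝓐≡ : ⟦ 𝓐 ⟧ v e ≡ ∑ j (λ p → ℤ.- sgn p ℤ.* x p)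
      𝓐≡ = trans (cong (λ y → y ℤ.+ sgn (suc j) ℤ.* x j) (∑-head j (λ p → sgn p ℤ.* ⟦ M p ∙ M (suc j ∸ p) ⟧ v e)))
        (trans (cong₂ (λ y z → 1ℤ ℤ.* y ℤ.+ ∑ j (λ p → ℤ.- sgn p ℤ.* x p) ℤ.+ sgn (suc j) ℤ.* z)
          (⟦⟧-0 (M 0) (M-beyond ℕₚ.≤-refl v) e) (M-beyond ℕₚ.≤-refl (⟦ M (j ∸ j) ⟧ v) e))
          (lemma″ 1ℤ (∑ j (λ p → ℤ.- sgn p ℤ.* x p)) (sgn (suc j))))

    -- The index sum j - 1 is too small for the outer products to vanish. They give the two end
    -- terms of 𝓑, because c₀ = b₀ and c_{j-1} = b_j.
    lowering-𝓒 : ∀ v e → ⟦ lowering ⟧ (⟦ 𝓒 ⟧ v) e ≡ ⟦ 𝓒 ⟧ (⟦ lowering ⟧ v) e ℤ.+ ⟦ 𝓑 ⟧ v e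
    lowering-𝓒 v e = trans (lowering-Quad c (suc t) v e) (cong (λ x → ⟦ 𝓒 ⟧ (⟦ lowering ⟧ v) e ℤ.+ x)
      (trans (cong₂ (λ y z → y ℤ.+ ∑ (suc t) (λ p → (c p ℤ.+ c (suc p)) ℤ.* x (suc p) (suc t ∸ p)) ℤ.+ z)
         (cong (ℤ._* x 0 (suc (suc t))) (lemma₀ (+ j)))
         (cong₂ (λ y z → y ℤ.* x (suc (suc t)) z) last (sym (ℕₚ.n∸n≡0 t))))
      (trans (cong (λ y → b 0 ℤ.* x 0 (suc (suc t)) ℤ.+ y ℤ.+ b (suc (suc t)) ℤ.* x (suc (suc t)) (t ∸ t))
         (∑-cong (suc t) (λ p _ → cong (ℤ._* x (suc p) (suc t ∸ p)) (lemma₁ (sgn p) (+ j) (+ p)))))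
      (trans (cong (λ y → y ℤ.+ b (suc (suc t)) ℤ.* x (suc (suc t)) (t ∸ t))
         (sym (∑-head (suc t) (λ p → b p ℤ.* x p (suc (suc t) ∸ p)))))
      (cong (λ i → ∑ (suc i) (λ p → b p ℤ.* x p (i ∸ p))) (sym j≡))))))
      where
      x : ℕ → ℕ → ℤ
      x p q = ⟦ M p ∙ M q ⟧ v e
      lemma₀ : ∀ j → 1ℤ ℤ.* ((0ℤ ℤ.+ 1ℤ) ℤ.* (j ℤ.- 0ℤ)) ≡ 1ℤ ℤ.* (j ℤ.- + 2 ℤ.* 0ℤ)
      lemma₀ = solve-∀
      lemma₁ : ∀ s j p → s ℤ.* ((p ℤ.+ 1ℤ) ℤ.* (j ℤ.- p)) ℤ.+ ℤ.- s ℤ.* ((1ℤ ℤ.+ p ℤ.+ 1ℤ) ℤ.* (j ℤ.- (1ℤ ℤ.+ p))) ≡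
        ℤ.- s ℤ.* (j ℤ.- + 2 ℤ.* (1ℤ ℤ.+ p))
      lemma₁ = solve-∀
      lemma₂ : ∀ s t → s ℤ.* ((1ℤ ℤ.+ t ℤ.+ 1ℤ) ℤ.* (+ 2 ℤ.+ t ℤ.- (1ℤ ℤ.+ t))) ≡ ℤ.- s ℤ.* (+ 2 ℤ.+ t ℤ.- + 2 ℤ.* (+ 2 ℤ.+ t))
      lemma₂ = solve-∀
      last : c (suc t) ≡ b (suc (suc t))
      last = subst (λ i → sgn (suc t) ℤ.* ((+ suc t ℤ.+ 1ℤ) ℤ.* (+ i ℤ.- + suc t)) ≡ sgn (suc (suc t)) ℤ.* (+ i ℤ.- + 2 ℤ.* + suc (suc t)))
        (sym j≡) (lemma₂ (sgn (suc t)) (+ t))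

    𝓓 : Op
    𝓓 = 𝓑 ∙ 𝓑 ⊹ (+ 4) · (𝓐 ∙ 𝓒)

    -- By Leibniz, 𝓑² contributes 2𝓑(-2𝓐) and 4𝓐𝓒 contributes 4𝓐𝓑, which cancel since quadrics
    -- commute.
    lowering-𝓓 : Commute lowering 𝓓
    lowering-𝓓 v e = begin
      ⟦ lowering ⟧ (⟦ 𝓓 ⟧ v) e
        ≡⟨ trans (⟦⟧-+ lowering (⟦ 𝓑 ∙ 𝓑 ⟧ v) (⟦ (+ 4) · (𝓐 ∙ 𝓒) ⟧ v) e) (cong₂ ℤ._+_ square product) ⟩
      (BBF ℤ.+ (ℤ.- + 2) ℤ.* AB ℤ.+ (ℤ.- + 2) ℤ.* AB) ℤ.+ + 4 ℤ.* (ACF ℤ.+ AB)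
        ≡⟨ lemma BBF ACF AB ⟩
      ⟦ 𝓓 ⟧ (⟦ lowering ⟧ v) e ∎
      where
      open ≡-Reasoning
      AB BBF ACF : ℤ
      AB  = ⟦ 𝓐 ⟧ (⟦ 𝓑 ⟧ v) e
      BBF = ⟦ 𝓑 ⟧ (⟦ 𝓑 ⟧ (⟦ lowering ⟧ v)) e
      ACF = ⟦ 𝓐 ⟧ (⟦ 𝓒 ⟧ (⟦ lowering ⟧ v)) e
      lemma : ∀ x y z → (x ℤ.+ (ℤ.- + 2) ℤ.* z ℤ.+ (ℤ.- + 2) ℤ.* z) ℤ.+ + 4 ℤ.* (y ℤ.+ z) ≡ x ℤ.+ + 4 ℤ.* y
      lemma = solve-∀
      square : ⟦ lowering ⟧ (⟦ 𝓑 ⟧ (⟦ 𝓑 ⟧ v)) e ≡ BBF ℤ.+ (ℤ.- + 2) ℤ.* AB ℤ.+ (ℤ.- + 2) ℤ.* AB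
      square = trans (lowering-𝓑 (⟦ 𝓑 ⟧ v) e) (cong (λ y → y ℤ.+ (ℤ.- + 2) ℤ.* AB) (trans
        (⟦⟧-ext 𝓑 (lowering-𝓑 v) e) (trans
        (⟦⟧-+ 𝓑 (⟦ 𝓑 ⟧ (⟦ lowering ⟧ v)) (λ e → (ℤ.- + 2) ℤ.* ⟦ 𝓐 ⟧ v e) e)
        (cong (λ y → BBF ℤ.+ y) (trans (⟦⟧-* 𝓑 (ℤ.- + 2) (⟦ 𝓐 ⟧ v) e)
          (cong ((ℤ.- + 2) ℤ.*_) (Quad-comm b j sgn (suc j) v e)))))))
      product : ⟦ lowering ⟧ (⟦ (+ 4) · (𝓐 ∙ 𝓒) ⟧ v) e ≡ + 4 ℤ.* (ACF ℤ.+ AB)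
      product = trans (⟦⟧-* lowering (+ 4) (⟦ 𝓐 ∙ 𝓒 ⟧ v) e) (cong (+ 4 ℤ.*_) (trans
        (sgn-Quad-commutes (suc j) (ℕₚ.n≤1+n j) (⟦ 𝓒 ⟧ v) e) (trans
        (⟦⟧-ext 𝓐 (lowering-𝓒 v) e)
        (⟦⟧-+ 𝓐 (⟦ 𝓒 ⟧ (⟦ lowering ⟧ v)) (⟦ 𝓑 ⟧ v) e))))

    -- 𝓐 is free of b₀ and 𝓒 is at most linear in it, so in b₀-degree two above the top of v only 𝓑²
    -- contributes. The descent for 𝓑, whose coefficient of b₀ b_j is 2j, is then applied twice.
    𝓓-descent : ∀ {v} → (∀ e → ⟦ 𝓓 ⟧ v e ≡ 0ℤ) → ∀ d → VanishFrom (suc d) v → VanishFrom d v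
    𝓓-descent {v} eq d z = descent z (descent (vanishFrom-𝓑 z) 𝓑𝓑v≡0)
      where
      1≤j : 1 ≤ j
      1≤j = subst (1 ≤_) (sym j≡) (s≤s z≤n)
      lemma₁ : ∀ j → 1ℤ ℤ.* (j ℤ.- + 2 ℤ.* 0ℤ) ℤ.+ -1ℤ ℤ.* (j ℤ.- + 2 ℤ.* j) ≡ j ℤ.+ j
      lemma₁ = solve-∀
      κ≢0 : b 0 ℤ.+ b j ≢ 0ℤ
      κ≢0 κ≡0 = ℕₚ.<⇒≢ 1≤j (sym (ℕₚ.m+n≡0⇒m≡0 j (ℤₚ.+-injective (trans (sym (trans
        (cong (λ s → b 0 ℤ.+ s ℤ.* (+ j ℤ.- + 2 ℤ.* + j)) odd) (lemma₁ (+ j)))) κ≡0))))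
      descent : ∀ {d u} → VanishFrom (suc d) u → VanishFrom (suc d) (⟦ 𝓑 ⟧ u) → VanishFrom d u
      descent = Quad-descent b 1≤j κ≢0
      vanishFrom-𝓑 : ∀ {d u} → VanishFrom d u → VanishFrom (suc d) (⟦ 𝓑 ⟧ u)
      vanishFrom-𝓑 {d} {u} z = subst (λ i → VanishFrom (suc d) (⟦ Quad b i ⟧ u)) (sym j≡)
        (vanishFrom-Quad b (suc t) z)
      lemma₂ : ∀ x y → x ≡ x ℤ.+ + 4 ℤ.* y ℤ.- + 4 ℤ.* y
      lemma₂ = solve-∀
      𝓑𝓑v≡0 : VanishFrom (suc (suc d)) (⟦ 𝓑 ⟧ (⟦ 𝓑 ⟧ v))
      𝓑𝓑v≡0 e d≤ = trans (lemma₂ (⟦ 𝓑 ∙ 𝓑 ⟧ v e) (⟦ 𝓐 ∙ 𝓒 ⟧ v e))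
        (cong₂ (λ x y → x ℤ.- + 4 ℤ.* y) (eq e) (vanishFrom-Quad-suc-j sgn (vanishFrom-Quad c t z) e d≤))

    quarticInvariant : Invariant 4 (j + j)
    quarticInvariant = record
      { op        = 𝓓
      ; gradedOp  = graded-⊹
          (graded-∙ (graded-Quad _ j j refl) (graded-Quad _ j j refl))
          (graded-· (+ 4) (subst (λ w → Graded 4 w (𝓐 ∙ 𝓒)) w≡
            (graded-∙ (graded-Quad _ (suc j) (suc t) w𝓐) (graded-Quad _ (suc t) (suc j) w𝓒))))
      ; commutes  = lowering-𝓓
      ; injective = λ {_} {n} sv eq → vanishFrom-descent (suc n) (𝓓-descent eq) (supp⇒vanishFrom sv)
      }
      where
      w≡ : suc t + suc j ≡ j + j
      w≡ = trans (ℕₚ.+-suc (suc t) j) (cong (λ i → i + j) (sym j≡))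
      w𝓐 : suc j + suc t ≡ j + j
      w𝓐 = trans (ℕₚ.+-comm (suc j) (suc t)) w≡
      w𝓒 : suc t + suc j ≡ j + j
      w𝓒 = w≡

  -- The discriminant of a binary form of degree j has the same degree and weight.
  invariant : 2 ≤ j → Invariant (2 * (j ∸ 1)) (j * (j ∸ 1))
  invariant 2≤j = byParity (parity j)
    where
    parity : ∀ p → (sgn p ≡ 1ℤ) ⊎ (∃ λ h → p ≡ suc (h + h) × sgn p ≡ -1ℤ)
    parity zero    = inj₁ refl
    parity (suc p) with parity p
    ... | inj₂ (_ , _ , eq) = inj₁ (cong ℤ.-_ eq)
    parity (suc zero) | inj₁ _ = inj₂ (0 , refl , refl)
    parity (suc (suc p)) | inj₁ eq with parity p
    ... | inj₁ eq′ = contradiction (trans (sym (cong ℤ.-_ eq′)) eq) λ ()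
    ... | inj₂ (h , refl , eq′) = inj₂ (suc h , cong (λ x → suc (suc x)) (sym (ℕₚ.+-suc h h)) , cong ℤ.-_ eq)
    byParity : (sgn j ≡ 1ℤ) ⊎ (∃ λ h → j ≡ suc (h + h) × sgn j ≡ -1ℤ) → Invariant (2 * (j ∸ 1)) (j * (j ∸ 1))
    byParity (inj₁ even) = subst₂ Invariant (ℕₚ.*-comm (j ∸ 1) 2) (ℕₚ.*-comm (j ∸ 1) j)
      (invariant-^ (quadraticInvariant (ℕₚ.<⇒≤ 2≤j) even) (j ∸ 1))
    byParity (inj₂ (h , j≡ , odd)) with ℕₚ.m≤n⇒∃[o]m+o≡n 2≤j
    ... | t , 2+t≡j = subst₂ Invariant
      (trans (lemma₁ h) (cong (2 *_) h+h≡))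
      (trans (lemma₂ h j) (cong (j *_) h+h≡))
      (invariant-^ (quarticInvariant (sym 2+t≡j) odd) h)
      where
      h+h≡ : h + h ≡ j ∸ 1
      h+h≡ = sym (cong (_∸ 1) j≡)
      lemma₁ : ∀ h → h * 4 ≡ 2 * (h + h)
      lemma₁ = ℕ-Solver.solve-∀
      lemma₂ : ∀ h j → h * (j + j) ≡ j * (h + h)
      lemma₂ = ℕ-Solver.solve-∀

  -- Comparing dimensions of weight spaces

  open Functional

  _≟ᴱ_ : DecidableEquality Exp
  _≟ᴱ_ = Vecₚ.≡-dec _≟_

  count : ℕ → ℕ → ℕ → ℕ
  count n o i = length (monomials j n o i)

  at-point : Op → Exp → Functional Exp
  at-point X e .app v       = ⟦ X ⟧ v e
  at-point X e .ext eq      = ⟦⟧-ext X eq e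
  at-point X e .lin a b u v = ⟦⟧-lin X a b u v e

  supported⇒supp : ∀ {o n i v} → Supported _≟ᴱ_ (monomials j n o i) v → Supp o n i v
  supported⇒supp {o} {n} {i} sv .vanish e ¬h = sv e (λ e∈ → ¬h (All.lookup (monomials-homogeneous j n o i) e∈))

  annihilated⇒zero : ∀ {o n i} {P : Exp → Set} → (∀ e → ¬ Homogeneous o n i e → P e) →
    All P (monomials j n o i) → ∀ e → P e
  annihilated⇒zero {o} {n} {i} out all e with homogeneous? o n i e
  ... | yes hom = All.lookup all (∈-monomials⁺ j n o i hom)
  ... | no ¬hom = out e ¬hom

  -- The coordinates of `raising` at the monomials of the next weight are as many functionals as
  -- that weight space has dimensions, and `raising` is injective because `lowering` after it is.
  count-increasing : ∀ n o i → i + i < j * n + (o + o) → count n o i ≤ count n o (suc i)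
  count-increasing n o i 2i<N = subst (count n o i ≤_) (length-map (at-point raising) (monomials j n o (suc i)))
    (length≤ _≟ᴱ_ (monomials j n o i) (monomials-unique j n o i) _ (λ v sv ann →
      lowering-raising-injective i (supported⇒supp sv) 2i<N
        (⟦⟧-0 lowering (annihilated⇒zero (vanish (raising-supp (supported⇒supp sv))) (Allₚ.map⁻ ann)))))

  homogeneous-reverse : ∀ {n o i i′} → i + i′ ≡ j * n + (o + o) → ∀ {e : Exp} →
    Homogeneous o n i e → Homogeneous o n i′ (reverse e)
  homogeneous-reverse {n} {o} i+i′≡N {e} (refl , refl) = deg-reverse e ,
    ℕₚ.+-cancelˡ-≡ (o + wt e) _ _ (trans (lemma o (wt e) (wt (reverse e)))
      (trans (cong (λ t → t + (o + o)) wt+wt≡) (sym i+i′≡N)))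
    where
    lemma : ∀ o x y → o + x + (o + y) ≡ x + y + (o + o)
    lemma = ℕ-Solver.solve-∀
    wt+wt≡ : wt e + wt (reverse e) ≡ j * deg e
    wt+wt≡ = ℕₚ.+-cancelʳ-≡ (deg e) _ _ (trans (wt-reverse e) (ℕₚ.+-comm (deg e) (j * deg e)))

  -- Reversing exponent vectors exchanges the weights r and j - r. The functionals are evaluations
  -- at the reversed monomials, so that `length≤` also counts this injection.
  count-mirror-≤ : ∀ n o i i′ → i + i′ ≡ j * n + (o + o) → count n o i ≤ count n o i′
  count-mirror-≤ n o i i′ i+i′≡N = subst (count n o i ≤_) (length-map (λ e → at-point I (reverse e)) (monomials j n o i′))
    (length≤ _≟ᴱ_ (monomials j n o i) (monomials-unique j n o i) _ (λ v sv ann →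
      annihilated⇒zero (vanish (supported⇒supp sv)) (All.tabulate (λ {e} e∈ →
        subst (λ e → v e ≡ 0ℤ) (Vecₚ.reverse-involutive e)
          (All.lookup (Allₚ.map⁻ ann) (∈-monomials⁺ j n o i′
            (homogeneous-reverse i+i′≡N (All.lookup (monomials-homogeneous j n o i) e∈))))))))

  count-mirror : ∀ n o i i′ → i + i′ ≡ j * n + (o + o) → count n o i ≡ count n o i′
  count-mirror n o i i′ eq = ℕₚ.≤-antisym (count-mirror-≤ n o i i′ eq)
    (count-mirror-≤ n o i′ i (trans (ℕₚ.+-comm i′ i) eq))

  count-empty : ∀ n o i → (∀ (e : Exp) → ¬ Homogeneous o n i e) → count n o i ≡ 0
  count-empty n o i ¬h with monomials j n o i | monomials-homogeneous j n o i
  ... | []    | _     = refl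
  ... | e ∷ _ | h ∷ _ = contradiction h (¬h e)

  count-beyond : ∀ n o i → j * n + (o + o) < i → count n o i ≡ 0
  count-beyond n o i N<i = count-empty n o i (λ { e (refl , refl) → ℕₚ.<⇒≱ N<i (begin
    o + wt e                     ≤⟨ ℕₚ.+-mono-≤ (ℕₚ.m≤m+n o o) (ℕₚ.m≤m+n (wt e) (wt (reverse e))) ⟩
    (o + o) + (wt e + wt (reverse e)) ≡⟨ ℕₚ.+-comm (o + o) _ ⟩
    wt e + wt (reverse e) + (o + o)   ≡⟨ cong (λ t → t + (o + o)) (ℕₚ.+-cancelʳ-≡ (deg e) _ _ (trans (wt-reverse e) (ℕₚ.+-comm (deg e) (j * deg e)))) ⟩
    j * deg e + (o + o)          ∎) })
    where open ℕₚ.≤-Reasoning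

  -- The map (v , u) ↦ (raising v + D u , lowering u) is injective: applying lowering to
  -- raising v + D u = 0 gives lowering (raising v) = 0, hence v = 0, D u = 0 and u = 0.
  count-supermodular : ∀ {d w} → Invariant d w → ∀ n o i → i + i < j * (d + n) + (o + o) →
    count (d + n) o i + count n (o + w) (suc i) ≤ count (d + n) o (suc i) + count n (o + w) i
  count-supermodular {d} {w} D n o i 2i<N = subst₂ _≤_ |S|≡ |Φ|≡ (length≤ _≟ˣ_ S unique Φ inj)
    where
    A A′ B B′ : List Exp
    A  = monomials j (d + n) o i
    A′ = monomials j (d + n) o (suc i)
    B  = monomials j n (o + w) (suc i)
    B′ = monomials j n (o + w) i

    X : Set
    X = Exp ⊎ Exp

    _≟ˣ_ : DecidableEquality X
    _≟ˣ_ = Sumₚ.≡-dec _≟ᴱ_ _≟ᴱ_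

    S : List X
    S = map inj₁ A ++ map inj₂ B

    pullback : (Exp → X) → Functional Exp → Functional X
    pullback g φ .app x       = app φ (λ e → x (g e))
    pullback g φ .ext eq      = ext φ (λ e → eq (g e))
    pullback g φ .lin a b u v = lin φ a b (λ e → u (g e)) (λ e → v (g e))

    φ ψ : Exp → Functional X
    φ e = combination 1ℤ (pullback inj₁ (at-point raising e)) 1ℤ (pullback inj₂ (at-point (op D) e))
    ψ e = pullback inj₂ (at-point lowering e)

    Φ : List (Functional X)
    Φ = map φ A′ ++ map ψ B′

    |S|≡ : length S ≡ length A + length B
    |S|≡ = trans (length-++ (map inj₁ A)) (cong₂ _+_ (length-map inj₁ A) (length-map inj₂ B))

    |Φ|≡ : length Φ ≡ length A′ + length B′
    |Φ|≡ = trans (length-++ (map φ A′)) (cong₂ _+_ (length-map φ A′) (length-map ψ B′))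

    disjoint : ∀ {x} → ¬ (x ∈ map inj₁ A × x ∈ map inj₂ B)
    disjoint (x∈A , x∈B) with ∈-map⁻ inj₁ x∈A | ∈-map⁻ inj₂ x∈B
    ... | _ , _ , refl | _ , _ , ()

    unique : Unique S
    unique = Uniqueₚ.++⁺ (Uniqueₚ.map⁺ Sumₚ.inj₁-injective (monomials-unique j (d + n) o i))
      (Uniqueₚ.map⁺ Sumₚ.inj₂-injective (monomials-unique j n (o + w) (suc i))) disjoint

    inj : ∀ x → Supported _≟ˣ_ S x → Annihilated _≟ˣ_ Φ x → ∀ y → x y ≡ 0ℤ
    inj x sx ann = λ { (inj₁ e) → v≡0 e ; (inj₂ e) → u≡0 e }
      where
      v u : Exp → ℤ
      v e = x (inj₁ e)
      u e = x (inj₂ e)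

      sv : Supp o (d + n) i v
      sv = supported⇒supp (λ e e∉ → sx (inj₁ e) (λ e∈ → [ inA e e∉ , inB e ]′ (∈-++⁻ (map inj₁ A) e∈)))
        where
        inA : ∀ e → e ∉ A → inj₁ e ∉ map inj₁ A
        inA e e∉ e∈ with ∈-map⁻ inj₁ e∈
        ... | _ , e∈A , refl = e∉ e∈A
        inB : ∀ e → inj₁ e ∉ map inj₂ B
        inB e e∈ with ∈-map⁻ inj₂ e∈
        ... | _ , _ , ()

      su : Supp (o + w) n (suc i) u
      su = supported⇒supp (λ e e∉ → sx (inj₂ e) (λ e∈ → [ inA e , inB e e∉ ]′ (∈-++⁻ (map inj₁ A) e∈)))
        where
        inA : ∀ e → inj₂ e ∉ map inj₁ A
        inA e e∈ with ∈-map⁻ inj₁ e∈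
        ... | _ , _ , ()
        inB : ∀ e → e ∉ B → inj₂ e ∉ map inj₂ B
        inB e e∉ e∈ with ∈-map⁻ inj₂ e∈
        ... | _ , e∈B , refl = e∉ e∈B

      Ev+Du≡0 : ∀ e → 1ℤ ℤ.* ⟦ raising ⟧ v e ℤ.+ 1ℤ ℤ.* ⟦ op D ⟧ u e ≡ 0ℤ
      Ev+Du≡0 = annihilated⇒zero
        (λ e ¬h → cong₂ (λ s t → 1ℤ ℤ.* s ℤ.+ 1ℤ ℤ.* t) (vanish (raising-supp sv) e ¬h) (vanish (supports (gradedOp D) su) e ¬h))
        (Allₚ.map⁻ (Allₚ.++⁻ˡ (map φ A′) ann))

      Fu≡0 : ∀ e → ⟦ lowering ⟧ u e ≡ 0ℤ
      Fu≡0 = annihilated⇒zero (vanish (lowering-supp su)) (Allₚ.map⁻ (Allₚ.++⁻ʳ (map φ A′) ann))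

      lemma : ∀ s t → s ≡ 1ℤ ℤ.* s ℤ.+ 1ℤ ℤ.* t ℤ.- t
      lemma = solve-∀

      FDu≡0 : ∀ e → ⟦ lowering ⟧ (⟦ op D ⟧ u) e ≡ 0ℤ
      FDu≡0 e = trans (commutes D u e) (⟦⟧-0 (op D) Fu≡0 e)

      v≡0 : ∀ e → v e ≡ 0ℤ
      v≡0 = lowering-raising-injective i sv 2i<N (λ e → trans (lemma (⟦ lowering ⟧ (⟦ raising ⟧ v) e) (⟦ lowering ⟧ (⟦ op D ⟧ u) e))
        (cong₂ ℤ._-_ (trans (sym (⟦⟧-lin lowering 1ℤ 1ℤ (⟦ raising ⟧ v) (⟦ op D ⟧ u) e)) (⟦⟧-0 lowering Ev+Du≡0 e)) (FDu≡0 e)))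

      u≡0 : ∀ e → u e ≡ 0ℤ
      u≡0 = injective D su (λ e → trans (lemma′ (⟦ raising ⟧ v e) (⟦ op D ⟧ u e)) (cong₂ ℤ._-_ (Ev+Du≡0 e) (⟦⟧-0 raising v≡0 e)))
        where
        lemma′ : ∀ s t → t ≡ 1ℤ ℤ.* s ℤ.+ 1ℤ ℤ.* t ℤ.- s
        lemma′ = solve-∀

-- Symmetric unimodal sequences

record Symmetric (N : ℕ) (a : ℕ → ℤ) : Set where
  field
    mirror : ∀ i i′ → i + i′ ≡ N → a i ≡ a i′
    beyond : ∀ i → N < i → a i ≡ 0ℤ

open Symmetric

symmetric-- : ∀ {N a b} → Symmetric N a → Symmetric N b → Symmetric N (λ i → a i ℤ.- b i)
symmetric-- sa sb .mirror i i′ eq = cong₂ ℤ._-_ (mirror sa i i′ eq) (mirror sb i i′ eq)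
symmetric-- sa sb .beyond i N<i   = cong₂ ℤ._-_ (beyond sa i N<i) (beyond sb i N<i)

symmetric-0 : ∀ {N} → Symmetric N (λ _ → 0ℤ)
symmetric-0 .mirror _ _ _ = refl
symmetric-0 .beyond _ _   = refl

symmetric-≗ : ∀ {N a b} → (∀ i → a i ≡ b i) → Symmetric N a → Symmetric N b
symmetric-≗ a≗b sa .mirror i i′ eq = trans (sym (a≗b i)) (trans (mirror sa i i′ eq) (a≗b i′))
symmetric-≗ a≗b sa .beyond i N<i   = trans (sym (a≗b i)) (beyond sa i N<i)

symmetric-count : ∀ {N} j n o → (o + o) + j * n ≡ N → Symmetric N (λ i → + length (monomials j n o i))
symmetric-count j n o refl .mirror i i′ eq = cong +_ (Representation.count-mirror j n o i i′ (trans eq (ℕₚ.+-comm (o + o) (j * n))))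
symmetric-count j n o refl .beyond i N<i   = cong +_ (Representation.count-beyond j n o i (subst (_< i) (ℕₚ.+-comm (o + o) (j * n)) N<i))

Increasing : ℕ → (ℕ → ℤ) → Set
Increasing N a = ∀ i → i + i < N → a i ℤ.≤ a (suc i)

-- If the given peak lies at or before i, the sequence falls from i + 1 to N - i, where its value is
-- again that at i.
unimodal⇒increasing : ∀ {N} p → Symmetric N (coeff p) → Unimodal p → Increasing N (coeff p)
unimodal⇒increasing {N} p s (t , up , down) i 2i<N with suc i ≤? t
... | yes i<t = up i i<t
... | no  i≮t = subst (ℤ._≤ coeff p (suc i)) (sym (mirror s i (suc i + d) eq)) (descend d)
  where
  gap : ∃ λ d → suc (i + i) + d ≡ N
  gap = ℕₚ.m≤n⇒∃[o]m+o≡n 2i<N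
  d : ℕ
  d = proj₁ gap
  lemma : ∀ i d → i + (suc i + d) ≡ suc (i + i) + d
  lemma = ℕ-Solver.solve-∀
  eq : i + (suc i + d) ≡ N
  eq = trans (lemma i d) (proj₂ gap)
  t≤i : t ≤ i
  t≤i = ℕₚ.≮⇒≥ i≮t
  descend : ∀ d → coeff p (suc i + d) ℤ.≤ coeff p (suc i)
  descend zero    = ℤₚ.≤-reflexive (cong (coeff p) (ℕₚ.+-identityʳ (suc i)))
  descend (suc d) = ℤₚ.≤-trans
    (subst (λ x → coeff p x ℤ.≤ coeff p (suc i + d)) (sym (ℕₚ.+-suc (suc i) d))
      (down (suc i + d) (ℕₚ.≤-trans t≤i (ℕₚ.≤-trans (ℕₚ.n≤1+n i) (ℕₚ.m≤m+n (suc i) d)))))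
    (descend d)

nonnegative-below : ∀ {N a} → Increasing N a → 0ℤ ℤ.≤ a 0 → ∀ i → i + i ≤ N → 0ℤ ℤ.≤ a i
nonnegative-below     inc 0≤a₀ zero    _    = 0≤a₀
nonnegative-below {N} inc 0≤a₀ (suc i) 2i≤N = ℤₚ.≤-trans (nonnegative-below inc 0≤a₀ i (ℕₚ.<⇒≤ 2i<N)) (inc i 2i<N)
  where
  2i<N : i + i < N
  2i<N = ℕₚ.≤-trans (s≤s (ℕₚ.+-monoʳ-≤ i (ℕₚ.n≤1+n i))) 2i≤N

increasing⇒nonnegative : ∀ {N} p → Symmetric N (coeff p) → Increasing N (coeff p) → 0ℤ ℤ.≤ coeff p 0 → Nonnegative p
increasing⇒nonnegative {N} p s inc 0≤p₀ i with i + i ≤? N | i ≤? N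
... | yes 2i≤N | _       = nonnegative-below inc 0≤p₀ i 2i≤N
... | no 2i≰N  | no  i≰N = ℤₚ.≤-reflexive (sym (beyond s i (ℕₚ.≰⇒> i≰N)))
... | no 2i≰N  | yes i≤N = subst (0ℤ ℤ.≤_) (sym (mirror s i (N ∸ i) (ℕₚ.m+[n∸m]≡n i≤N))) (nonnegative-below inc 0≤p₀ (N ∸ i) 2i′≤N)
  where
  2i′≤N : (N ∸ i) + (N ∸ i) ≤ N
  2i′≤N = ℕₚ.≤-trans (ℕₚ.+-monoˡ-≤ (N ∸ i) (ℕₚ.m≤n+o⇒m∸n≤o N i (ℕₚ.<⇒≤ (ℕₚ.≰⇒> 2i≰N)))) (ℕₚ.≤-reflexive (ℕₚ.m+[n∸m]≡n i≤N))

increasing⇒unimodal : ∀ {N} p → Symmetric N (coeff p) → Increasing N (coeff p) → Nonnegative p → Unimodal p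
increasing⇒unimodal {N} p s inc nonneg = ⌊ N /2⌋ , up , down
  where
  up : ∀ i → suc i ≤ ⌊ N /2⌋ → coeff p i ℤ.≤ coeff p (suc i)
  up i i<h = inc i (begin-strict
    i + i             <⟨ ℕₚ.+-mono-<-≤ i<h (ℕₚ.≤-trans (ℕₚ.<⇒≤ i<h) (ℕₚ.⌊n/2⌋≤⌈n/2⌉ N)) ⟩
    ⌊ N /2⌋ + ⌈ N /2⌉ ≡⟨ ℕₚ.⌊n/2⌋+⌈n/2⌉≡n N ⟩
    N                 ∎)
    where open ℕₚ.≤-Reasoning
  down : ∀ i → ⌊ N /2⌋ ≤ i → coeff p (suc i) ℤ.≤ coeff p i
  down i h≤i with suc i ≤? N
  ... | no  i≮N = subst (ℤ._≤ coeff p i) (sym (beyond s (suc i) (ℕₚ.≰⇒> i≮N))) (nonneg i)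
  ... | yes i<N = subst₂ ℤ._≤_ (sym (mirror s (suc i) d eq)) (sym (mirror s i (suc d) (trans (ℕₚ.+-suc i d) eq))) (inc d 2d<N)
    where
    d : ℕ
    d = N ∸ suc i
    eq : suc i + d ≡ N
    eq = ℕₚ.m+[n∸m]≡n i<N
    N≤ : N ≤ suc i + i
    N≤ = begin
      N                 ≡⟨ sym (ℕₚ.⌊n/2⌋+⌈n/2⌉≡n N) ⟩
      ⌊ N /2⌋ + ⌈ N /2⌉ ≤⟨ ℕₚ.+-mono-≤ h≤i (ℕₚ.≤-trans (ℕₚ.⌊n/2⌋-mono (ℕₚ.n≤1+n (suc N))) (s≤s h≤i)) ⟩
      i + suc i         ≡⟨ ℕₚ.+-comm i (suc i) ⟩
      suc i + i         ∎
      where open ℕₚ.≤-Reasoning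
    2d<N : d + d < N
    2d<N = ℕₚ.<-≤-trans (s≤s (ℕₚ.+-monoˡ-≤ d (ℕₚ.m≤n+o⇒m∸n≤o N (suc i) N≤))) (ℕₚ.≤-reflexive eq)

-- Exponents and coefficients of `f`

[y*2]/2≡y : ∀ y → (y ℤ.* + 2) /ℕ 2 ≡ y
[y*2]/2≡y y = remainder (x %ℕ 2) (n%ℕd<d x 2) (a≡a%ℕn+[a/ℕn]*n x 2)
  where
  x q : ℤ
  x = y ℤ.* + 2
  q = x /ℕ 2
  lemma₁ : ∀ y q → (y ℤ.- q) ℤ.* + 2 ≡ y ℤ.* + 2 ℤ.- q ℤ.* + 2
  lemma₁ = solve-∀
  lemma₂ : ∀ q → 1ℤ ℤ.+ q ℤ.* + 2 ℤ.- q ℤ.* + 2 ≡ 1ℤ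
  lemma₂ = solve-∀
  z*2≢1 : ∀ z → z * 2 ≢ 1
  z*2≢1 zero    ()
  z*2≢1 (suc z) ()
  remainder : ∀ r → r < 2 → x ≡ + r ℤ.+ q ℤ.* + 2 → q ≡ y
  remainder zero          _               eq = ℤₚ.*-cancelʳ-≡ q y (+ 2) (sym (trans eq (ℤₚ.+-identityˡ (q ℤ.* + 2))))
  remainder (suc zero)    _               eq = contradiction
    (trans (sym (ℤₚ.abs-* (y ℤ.- q) (+ 2)))
      (cong ℤ.∣_∣ (trans (lemma₁ y q) (trans (cong (λ t → t ℤ.- q ℤ.* + 2) eq) (lemma₂ q)))))
    (z*2≢1 ℤ.∣ y ℤ.- q ∣)
  remainder (suc (suc r)) (s≤s (s≤s ())) _

fexp-even : ∀ k m b y → (+ k) ℤ.* ((+ m) ℤ.- b) ≡ y ℤ.* + 2 → fexp k m b ≡ y ℤ.+ b ℤ.- + (2 * k) ℤ.+ + 2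
fexp-even k m b y eq = cong (λ x → x ℤ.+ b ℤ.- + (2 * k) ℤ.+ + 2) (trans (cong (_/ℕ 2) eq) ([y*2]/2≡y y))

coeff-f : ∀ j M n b e → b ≡ + (n + j) → fexp (suc (suc j)) (suc (suc j) + M) b ≡ + e → ∀ i →
  coeff (f (suc (suc j)) (suc (suc j) + M) b) i ≡
  + length (monomials (suc (suc j)) M 0 i) ℤ.- + length (monomials j n e i)
coeff-f j M n b e refl fexp≡e i = trans
  (coeff-⊝ (qbinom (suc (suc j) + M) (suc (suc j))) _ i)
  (cong₂ ℤ._-_
    (trans (cong (λ m → coeff (qbinom m (suc (suc j))) i) (ℕₚ.+-comm (suc (suc j)) M)) (coeff-shift-qbinom (suc (suc j)) M 0 i))
    (trans (cong (λ x → coeff (shift ℤ.∣ x ∣ (qbinom (n + j) j)) i) fexp≡e) (coeff-shift-qbinom j n e i)))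

-- Covers negative b too. The polynomial being shifted is 0, so the exponent may take any value.
coeff-f-small : ∀ j M b → b ℤ.< + j → ∀ i →
  coeff (f (suc (suc j)) (suc (suc j) + M) b) i ≡ + length (monomials (suc (suc j)) M 0 i) ℤ.- 0ℤ
coeff-f-small j M b b<j i = trans
  (coeff-⊝ (qbinom (suc (suc j) + M) (suc (suc j))) _ i)
  (cong₂ ℤ._-_
    (trans (cong (λ m → coeff (qbinom m (suc (suc j))) i) (ℕₚ.+-comm (suc (suc j)) M)) (coeff-shift-qbinom (suc (suc j)) M 0 i))
    (trans (coeff-shift-cong ℤ.∣ fexp (suc (suc j)) (suc (suc j) + M) b ∣ (qbinomℤ b j) [] (small b b<j) i)
      (coeff-shift-[] ℤ.∣ fexp (suc (suc j)) (suc (suc j) + M) b ∣ i)))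
  where
  small : ∀ b → b ℤ.< + j → ∀ i → coeff (qbinomℤ b j) i ≡ 0ℤ
  small (+ n)    n<j i = coeff-qbinom-< n j (ℤₚ.drop‿+<+ n<j) i
  small -[1+ n ] _   i = refl

-- This identity says that the two terms of `f`, of degrees (2 + j)·M and j·n before shifting, have
-- a common centre.
exponent : ∀ j M n y → (+ (2 + j)) ℤ.* (+ (2 + j + M) ℤ.- + (n + j)) ≡ y ℤ.* + 2 →
  + 2 ℤ.* (y ℤ.+ + (n + j) ℤ.- + (2 * (2 + j)) ℤ.+ + 2) ≡ + ((2 + j) * M) ℤ.- + (j * n)
exponent j M n y eq = begin
  + 2 ℤ.* (y ℤ.+ + (n + j) ℤ.- + (2 * (2 + j)) ℤ.+ + 2)
    ≡⟨ cong (λ t → + 2 ℤ.* (y ℤ.+ + (n + j) ℤ.- t ℤ.+ + 2)) (ℤₚ.pos-* 2 (2 + j)) ⟩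
  + 2 ℤ.* (y ℤ.+ (+ n ℤ.+ + j) ℤ.- + 2 ℤ.* (+ 2 ℤ.+ + j) ℤ.+ + 2)
    ≡⟨ lemma₁ y (+ n) (+ j) ⟩
  y ℤ.* + 2 ℤ.+ (+ 2 ℤ.* + n ℤ.- + 2 ℤ.* + j ℤ.- + 4)
    ≡⟨ cong (λ t → t ℤ.+ (+ 2 ℤ.* + n ℤ.- + 2 ℤ.* + j ℤ.- + 4)) (sym eq) ⟩
  (+ 2 ℤ.+ + j) ℤ.* ((+ 2 ℤ.+ + j ℤ.+ + M) ℤ.- (+ n ℤ.+ + j)) ℤ.+ (+ 2 ℤ.* + n ℤ.- + 2 ℤ.* + j ℤ.- + 4)
    ≡⟨ lemma₂ (+ n) (+ j) (+ M) ⟩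
  (+ 2 ℤ.+ + j) ℤ.* + M ℤ.- + j ℤ.* + n
    ≡⟨ cong₂ ℤ._-_ (sym (ℤₚ.pos-* (2 + j) M)) (sym (ℤₚ.pos-* j n)) ⟩
  + ((2 + j) * M) ℤ.- + (j * n) ∎
  where
  open ≡-Reasoning
  lemma₁ : ∀ y n j → + 2 ℤ.* (y ℤ.+ (n ℤ.+ j) ℤ.- + 2 ℤ.* (+ 2 ℤ.+ j) ℤ.+ + 2) ≡ y ℤ.* + 2 ℤ.+ (+ 2 ℤ.* n ℤ.- + 2 ℤ.* j ℤ.- + 4)
  lemma₁ = solve-∀
  lemma₂ : ∀ n j M → (+ 2 ℤ.+ j) ℤ.* ((+ 2 ℤ.+ j ℤ.+ M) ℤ.- (n ℤ.+ j)) ℤ.+ (+ 2 ℤ.* n ℤ.- + 2 ℤ.* j ℤ.- + 4) ≡ (+ 2 ℤ.+ j) ℤ.* M ℤ.- j ℤ.* n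
  lemma₂ = solve-∀

double-sum : ∀ e A B → + 2 ℤ.* + e ≡ + A ℤ.- + B → (e + e) + B ≡ A
double-sum e A B eq = ℤₚ.+-injective (trans (lemma₁ (+ e) (+ B)) (trans (cong (λ t → t ℤ.+ + B) eq) (lemma₂ (+ A) (+ B))))
  where
  lemma₁ : ∀ e B → (e ℤ.+ e) ℤ.+ B ≡ + 2 ℤ.* e ℤ.+ B
  lemma₁ = solve-∀
  lemma₂ : ∀ A B → A ℤ.- B ℤ.+ B ≡ A
  lemma₂ = solve-∀

sum-double : ∀ e A B → (e + e) + B ≡ A → + 2 ℤ.* + e ≡ + A ℤ.- + B
sum-double e _ B refl = lemma (+ e) (+ B)
  where
  lemma : ∀ e B → + 2 ℤ.* e ≡ (e ℤ.+ e) ℤ.+ B ℤ.- B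
  lemma = solve-∀

-- P cancels in increments: that of p′ is that of p plus that of Q - Q′, both nonnegative below the
-- middle. The value of p′ at 0 is P 0, a count, where nonnegativity starts.
nonnegative-unimodal : ∀ {N} p p′ (P Q Q′ : ℕ → ℕ) →
  (∀ i → coeff p i ≡ + P i ℤ.- + Q i) → (∀ i → coeff p′ i ≡ + P i ℤ.- + Q′ i) →
  Symmetric N (λ i → + P i) → Symmetric N (λ i → + Q i) → Symmetric N (λ i → + Q′ i) →
  Q′ 0 ≡ 0 → (∀ i → i + i < N → Q i + Q′ (suc i) ≤ Q (suc i) + Q′ i) →
  Unimodal p → Nonnegative p′ × Unimodal p′
nonnegative-unimodal {N} p p′ P Q Q′ p≡ p′≡ sP sQ sQ′ Q′₀≡0 supermodular unimodal =
  nonneg , increasing⇒unimodal p′ sp′ increasing nonneg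
  where
  sp : Symmetric N (coeff p)
  sp = symmetric-≗ (λ i → sym (p≡ i)) (symmetric-- sP sQ)
  sp′ : Symmetric N (coeff p′)
  sp′ = symmetric-≗ (λ i → sym (p′≡ i)) (symmetric-- sP sQ′)
  lemma₁ : ∀ a x y z → a ℤ.- y ≡ a ℤ.- x ℤ.+ (x ℤ.+ z) ℤ.+ ℤ.- (y ℤ.+ z)
  lemma₁ = solve-∀
  lemma₂ : ∀ a x y z → a ℤ.- x ℤ.+ (x ℤ.+ z) ℤ.+ ℤ.- (z ℤ.+ y) ≡ a ℤ.- y
  lemma₂ = solve-∀
  increasing : Increasing N (coeff p′)
  increasing i 2i<N = begin
    coeff p′ i
      ≡⟨ trans (p′≡ i) (lemma₁ (+ P i) (+ Q i) (+ Q′ i) (+ Q′ (suc i))) ⟩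
    + P i ℤ.- + Q i ℤ.+ + (Q i + Q′ (suc i)) ℤ.+ ℤ.- + (Q′ i + Q′ (suc i))
      ≤⟨ ℤₚ.+-monoˡ-≤ (ℤ.- + (Q′ i + Q′ (suc i))) (ℤₚ.+-mono-≤
           (subst₂ ℤ._≤_ (p≡ i) (p≡ (suc i)) (unimodal⇒increasing p sp unimodal i 2i<N))
           (ℤ.+≤+ (supermodular i 2i<N))) ⟩
    + P (suc i) ℤ.- + Q (suc i) ℤ.+ + (Q (suc i) + Q′ i) ℤ.+ ℤ.- + (Q′ i + Q′ (suc i))
      ≡⟨ trans (lemma₂ (+ P (suc i)) (+ Q (suc i)) (+ Q′ (suc i)) (+ Q′ i)) (sym (p′≡ (suc i))) ⟩
    coeff p′ (suc i) ∎
    where open ℤₚ.≤-Reasoning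
  nonneg : Nonnegative p′
  nonneg = increasing⇒nonnegative p′ sp′ increasing
    (subst (0ℤ ℤ.≤_) (sym (trans (p′≡ 0) (trans (cong (λ t → + P 0 ℤ.- + t) Q′₀≡0) (ℤₚ.+-identityʳ (+ P 0))))) (ℤ.+≤+ z≤n))

-- Passing from b to b - (2k - 6)

module Step (h M n : ℕ) (y : ℤ) where

  j k m : ℕ
  j = 2 + h
  k = 2 + j
  m = k + M

  b b′ : ℤ
  b  = + (n + j)
  b′ = b ℤ.- ((+ 2) ℤ.* (+ k) ℤ.- (+ 6))

  module _ (even : (+ k) ℤ.* ((+ m) ℤ.- b) ≡ y ℤ.* + 2)
           (bound : ((+ k) ℤ.- (+ 2)) ℤ.* b ℤ.≤ (+ k) ℤ.* (+ m) ℤ.- (+ 4) ℤ.* (+ k) ℤ.+ (+ 4)) where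

    e : ℕ
    e = ℤ.∣ fexp k m b ∣

    2*fexp≡ : + 2 ℤ.* fexp k m b ≡ + (k * M) ℤ.- + (j * n)
    2*fexp≡ = trans (cong (+ 2 ℤ.*_) (fexp-even k m b y even)) (exponent j M n y even)

    -- The upper bound on b rearranges to j·n ≤ k·M, which is nonnegativity of twice the exponent;
    -- the absolute value in `f` therefore changes nothing.
    fexp≡e : fexp k m b ≡ + e
    fexp≡e = sym (ℤₚ.0≤i⇒+∣i∣≡i (ℤₚ.*-cancelˡ-≤-pos 0ℤ (fexp k m b) (+ 2)
      (subst (0ℤ ℤ.≤_) (trans bound≡ (sym 2*fexp≡)) (ℤₚ.i≤j⇒0≤j-i bound))))
      where
      lemma : ∀ j n M → (+ 2 ℤ.+ j) ℤ.* (+ 2 ℤ.+ j ℤ.+ M) ℤ.- (+ 4) ℤ.* (+ 2 ℤ.+ j) ℤ.+ (+ 4) ℤ.- ((+ 2 ℤ.+ j) ℤ.- (+ 2)) ℤ.* (n ℤ.+ j) ≡ (+ 2 ℤ.+ j) ℤ.* M ℤ.- j ℤ.* n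
      lemma = solve-∀
      bound≡ : (+ k) ℤ.* (+ m) ℤ.- (+ 4) ℤ.* (+ k) ℤ.+ (+ 4) ℤ.- ((+ k) ℤ.- (+ 2)) ℤ.* b ≡ + (k * M) ℤ.- + (j * n)
      bound≡ = trans (lemma (+ j) (+ n) (+ M)) (cong₂ ℤ._-_ (sym (ℤₚ.pos-* k M)) (sym (ℤₚ.pos-* j n)))

    2e+jn≡N : (e + e) + j * n ≡ k * M
    2e+jn≡N = double-sum e (k * M) (j * n) (trans (cong (+ 2 ℤ.*_) (sym fexp≡e)) 2*fexp≡)

    conclude : ∀ (Q′ : ℕ → ℕ) → (∀ i → coeff (f k m b′) i ≡ + Representation.count k M 0 i ℤ.- + Q′ i) →
      Symmetric (k * M) (λ i → + Q′ i) → Q′ 0 ≡ 0 →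
      (∀ i → i + i < j * n + (e + e) → Representation.count j n e i + Q′ (suc i) ≤ Representation.count j n e (suc i) + Q′ i) →
      Unimodal (f k m b) → Nonnegative (f k m b′) × Unimodal (f k m b′)
    conclude Q′ f≡ sQ′ Q′₀≡0 supermodular = nonnegative-unimodal (f k m b) (f k m b′)
      (Representation.count k M 0) (Representation.count j n e) Q′ (coeff-f j M n b e refl fexp≡e) f≡
      (symmetric-count k M 0 refl) (symmetric-count j n e 2e+jn≡N) sQ′ Q′₀≡0
      (λ i 2i<N → supermodular i (subst (i + i <_) (trans (sym 2e+jn≡N) (ℕₚ.+-comm (e + e) (j * n))) 2i<N))

    large : ∀ n′ → n ≡ 2 * (j ∸ 1) + n′ → Unimodal (f k m b) → Nonnegative (f k m b′) × Unimodal (f k m b′)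
    large n′ refl = conclude (Representation.count j n′ e′) (coeff-f j M n′ b′ e′ b′≡ fexp′≡)
      (symmetric-count j n′ e′ 2e′+jn′≡N)
      -- The shift e′ is at least j(j - 1) > 0, so the subtracted polynomial has no constant term.
      (Representation.count-empty j n′ e′ 0 (λ x hom → contradiction (ℕₚ.m+n≡0⇒n≡0 e (ℕₚ.m+n≡0⇒m≡0 e′ (Homogeneous.wt≡ hom))) λ ()))
      (Representation.count-supermodular j (Representation.invariant j (s≤s (s≤s z≤n))) n′ e)
      where
      e′ : ℕ
      e′ = e + j * (j ∸ 1)
      lemma₁ : ∀ h n′ → + 2 ℤ.* (1ℤ ℤ.+ h) ℤ.+ n′ ℤ.+ (+ 2 ℤ.+ h) ℤ.- ((+ 2) ℤ.* (+ 4 ℤ.+ h) ℤ.- (+ 6)) ≡ n′ ℤ.+ (+ 2 ℤ.+ h)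
      lemma₁ = solve-∀
      b′≡ : b′ ≡ + (n′ + j)
      b′≡ = trans (cong (λ t → t ℤ.+ + n′ ℤ.+ + j ℤ.- ((+ 2) ℤ.* (+ k) ℤ.- (+ 6))) (ℤₚ.pos-* 2 (1 + h))) (lemma₁ (+ h) (+ n′))
      y′ : ℤ
      -- Lowering b by 2k - 6 adds k(2k - 6) to k(m - b), and half of that is k(k - 3).
      y′ = y ℤ.+ + k ℤ.* (+ k ℤ.- + 3)
      lemma₂ : ∀ k m b → k ℤ.* (m ℤ.- (b ℤ.- (+ 2 ℤ.* k ℤ.- + 6))) ≡ k ℤ.* (m ℤ.- b) ℤ.+ k ℤ.* (k ℤ.- + 3) ℤ.* + 2
      lemma₂ = solve-∀
      lemma₃ : ∀ y z → y ℤ.* + 2 ℤ.+ z ℤ.* + 2 ≡ (y ℤ.+ z) ℤ.* + 2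
      lemma₃ = solve-∀
      even′ : + k ℤ.* (+ m ℤ.- b′) ≡ y′ ℤ.* + 2
      even′ = trans (lemma₂ (+ k) (+ m) b) (trans (cong (λ t → t ℤ.+ + k ℤ.* (+ k ℤ.- + 3) ℤ.* + 2) even) (lemma₃ y (+ k ℤ.* (+ k ℤ.- + 3))))
      lemma₄ : ∀ e h n′ → ((e + (2 + h) * (1 + h)) + (e + (2 + h) * (1 + h))) + (2 + h) * n′ ≡ (e + e) + (2 + h) * (2 * (1 + h) + n′)
      lemma₄ = ℕ-Solver.solve-∀
      2e′+jn′≡N : (e′ + e′) + j * n′ ≡ k * M
      2e′+jn′≡N = trans (lemma₄ e h n′) 2e+jn≡N
      fexp′≡ : fexp k m b′ ≡ + e′
      fexp′≡ = ℤₚ.*-cancelˡ-≡ (+ 2) (fexp k m b′) (+ e′) (trans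
        (cong (+ 2 ℤ.*_) (trans (fexp-even k m b′ y′ even′) (cong (λ t → y′ ℤ.+ t ℤ.- + (2 * k) ℤ.+ + 2) b′≡)))
        (trans (exponent j M n′ y′ (trans (cong (λ t → + k ℤ.* (+ m ℤ.- t)) (sym b′≡)) even′))
          (sym (sum-double e′ (k * M) (j * n′) 2e′+jn′≡N))))

    small : n < 2 * (j ∸ 1) → Unimodal (f k m b) → Nonnegative (f k m b′) × Unimodal (f k m b′)
    small n<d = conclude (λ _ → 0) (coeff-f-small j M b′ b′<j) symmetric-0 refl
      (λ i 2i<N → subst₂ _≤_ (sym (ℕₚ.+-identityʳ _)) (sym (ℕₚ.+-identityʳ _)) (Representation.count-increasing j n e i 2i<N))
      where
      lemma : ∀ h → + 2 ℤ.* (1ℤ ℤ.+ h) ℤ.+ (+ 2 ℤ.+ h) ℤ.- ((+ 2) ℤ.* (+ 4 ℤ.+ h) ℤ.- (+ 6)) ≡ + 2 ℤ.+ h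
      lemma = solve-∀
      -- Since b = n + j with n < 2(j - 1) = 2k - 6, subtracting 2k - 6 leaves less than j.
      b′<j : b′ ℤ.< + j
      b′<j = subst (b′ ℤ.<_)
        (trans (cong (λ t → t ℤ.+ + j ℤ.- ((+ 2) ℤ.* (+ k) ℤ.- (+ 6))) (ℤₚ.pos-* 2 (1 + h))) (lemma (+ h)))
        (ℤₚ.+-monoˡ-< (ℤ.- ((+ 2) ℤ.* (+ k) ℤ.- (+ 6))) (ℤ.+<+ (ℕₚ.+-monoˡ-< j n<d)))

    step : Unimodal (f k m b) → Nonnegative (f k m b′) × Unimodal (f k m b′)
    step with 2 * (j ∸ 1) ≤? n
    ... | no  d≰n = small (ℕₚ.≰⇒> d≰n)
    ... | yes d≤n = large (n ∸ 2 * (j ∸ 1)) (sym (ℕₚ.m+[n∸m]≡n d≤n))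

+j≤b⇒b≡+[n+j] : ∀ {j b} → + j ℤ.≤ b → ∃ λ n → b ≡ + (n + j)
+j≤b⇒b≡+[n+j] {j} {+ b} (ℤ.+≤+ j≤b) = b ∸ j , cong +_ (sym (ℕₚ.m∸n+n≡m j≤b))

theorem2p3 : (k m : ℕ) (b : ℤ) → 4 ≤ k → k ≤ m →
    (+ k) ℤ.- (+ 2) ℤ.≤ b →
    ((+ k) ℤ.- (+ 2)) ℤ.* b ℤ.≤ (+ k) ℤ.* (+ m) ℤ.- (+ 4) ℤ.* (+ k) ℤ.+ (+ 4) →
    (+ 2) ∣ ((+ k) ℤ.* ((+ m) ℤ.- b)) →
    Nonnegative (f k m b) × Unimodal (f k m b) →
    Nonnegative (f k m (b ℤ.- ((+ 2) ℤ.* (+ k) ℤ.- (+ 6)))) ×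
    Unimodal (f k m (b ℤ.- ((+ 2) ℤ.* (+ k) ℤ.- (+ 6))))
-- Peeling 4 off k gives k = 4 + h and j = 2 + h ≥ 2, the range in which `invariant` supplies D.
theorem2p3 k m b (s≤s (s≤s (s≤s (s≤s {n = h} z≤n)))) k≤m k-2≤b bound 2∣ (_ , unimodal)
  with ℕₚ.m≤n⇒∃[o]m+o≡n k≤m | +j≤b⇒b≡+[n+j] k-2≤b | Signed.∣ᵤ⇒∣ {+ 2} {(+ k) ℤ.* ((+ m) ℤ.- b)} 2∣
... | M , refl | n , refl | Signed.divides y even = Step.step h M n y even bound unimodal
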